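{- Let $T$ be a tournament on $n$ vertices and let $k,t\in \mathbb{N}$ with $t\geq 2$. If $T$ is strongly $10^7k^6t^3\log (kt^2)$-connected, then there exists a partition of $V(T)$ into $t$ vertex classes $V_1,\dots, V_t$ such that for all $i\in \{1,\dots, t\}$ the subtournament $T[V_i]$ is strongly $k$-connected.
   Context: A tournament is an orientation of a complete graph. A tournament is strongly connected if for every ordered pair of vertices $u,v$ there is a directed path from $u$ to $v$. For $k\in\mathbb{N}$, a tournament $T$ is strongly $k$-connected if $|V(T)|>k$ and the removal of any set of fewer than $k$ vertices results in a strongly connected tournament. $T[U]$ denotes the subtournament induced by $U\subseteq V(T)$. Here $\log$ denotes $\log_2$. -}

module Defs where

open import Level using (0ℓ)
open import Data.Nat using (ℕ; _<_; _^_)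
open import Data.Nat.Logarithm using (⌈log₂_⌉)
open import Data.Fin using (Fin)
open import Data.Fin.Subset using (Subset; _∈_; _⊆_; _─_; ∣_∣; Nonempty)
open import Data.List using (List; []; _∷_)
open import Data.List.Relation.Unary.Unique.Propositional using (Unique)
open import Data.Product using (∃; ∃!; _×_; _,_; proj₁)
open import Data.Vec.Properties.WithK using ([]=-irrelevant)
open import Relation.Binary using (Rel; Trichotomous; Tri; tri<; tri≈; tri>)
open import Relation.Binary.Construct.Closure.ReflexiveTransitive using (Star; ε; _◅_)
open import Relation.Binary.PropositionalEquality using (_≡_; refl; cong)

-- Trichotomy says that exactly one of u ⇒ v, u ≡ v, v ⇒ u holds: there are no
-- loops, and each pair of distinct vertices is joined by exactly one arc.
record Tournament (A : Set) : Set₁ where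
  field
    _⇒_          : Rel A 0ℓ
    trichotomous : Trichotomous _≡_ _⇒_

_[_] : ∀ {n} → Tournament (Fin n) → (U : Subset n) → Tournament (∃ (_∈ U))
_[_] {n} T U = record { _⇒_ = λ u v → proj₁ u ⇒ proj₁ v ; trichotomous = compare }
  where
  open Tournament T

  ext : {u v : ∃ (_∈ U)} → proj₁ u ≡ proj₁ v → u ≡ v
  ext {u , p} {.u , q} refl = cong (u ,_) ([]=-irrelevant p q)

  compare : Trichotomous _≡_ (λ (u v : ∃ (_∈ U)) → proj₁ u ⇒ proj₁ v)
  compare u v with trichotomous (proj₁ u) (proj₁ v)
  ... | tri< a ¬b ¬c = tri< a (λ e → ¬b (cong proj₁ e)) ¬c
  ... | tri≈ ¬a b ¬c = tri≈ ¬a (ext b) ¬c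
  ... | tri> ¬a ¬b c = tri> ¬a (λ e → ¬b (cong proj₁ e)) c

vertices : ∀ {A : Set} {R : Rel A 0ℓ} {u v} → Star R u v → List A
vertices {u = u} ε       = u ∷ []
vertices {u = u} (_ ◅ w) = u ∷ vertices w

-- An element of Star R u v is a directed walk; a path repeats no vertex.
Path : ∀ {A : Set} → Rel A 0ℓ → Rel A 0ℓ
Path R u v = ∃ λ (w : Star R u v) → Unique (vertices w)

StronglyConnected : ∀ {A : Set} → Tournament A → Set
StronglyConnected T = ∀ u v → Path (Tournament._⇒_ T) u v

-- "T [ U ] is strongly k-connected".  Deleting S from T [ U ] leaves
-- T [ U ─ S ]; the tournament T itself is the case where U is the full set.
StronglyKConnected : ∀ {n} → ℕ → Tournament (Fin n) → Subset n → Set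
StronglyKConnected k T U =
  k < ∣ U ∣ × (∀ S → S ⊆ U → ∣ S ∣ < k → StronglyConnected (T [ U ─ S ]))

IsPartition : ∀ {n t} → (Fin t → Subset n) → Set
IsPartition V = (∀ i → Nonempty (V i)) × (∀ v → ∃! _≡_ (λ i → v ∈ V i))

-- The least natural number that is at least the real number c · log₂ m, for
-- m ≥ 1.  The factor c is inside the logarithm so that rounding comes last:
-- c · log₂ m = log₂ (m ^ c).
⌈_·log₂_⌉ : ℕ → ℕ → ℕ
⌈ c ·log₂ m ⌉ = ⌈log₂ (m ^ c) ⌉

{-# OPTIONS --safe #-}

-- It suffices to cut off one class: if U is strongly (κ + O(k⁵))-connected then
-- U = H ⊎ R with T[H] strongly k-connected and T[R] strongly κ-connected.
--
-- Choose k disjoint bounded fans A (transitive, every vertex of A dominating the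
-- root) such that all vertices outside an exceptional set E send an arc into
-- every A, and k such fans B for the reversed tournament, with exceptional set E′.
-- Starting a fan at a vertex of minimum out-degree and halving its common
-- out-neighbourhood makes E small compared with every out-degree outside the
-- fans.  Join roots of fans A to roots of fans B by k disjoint paths, each a
-- geodesic in what remains.  Deleting a geodesic P lowers the connectivity by at
-- most 4: if no arc leads from X to Y then Y ⇒ X, so P can leave for Y and come
-- back from X only within a window of four vertices.  Hence no linkage theorem is
-- needed and the remainder stays highly connected, however long the paths are.
--
-- H consists of the fans, the paths and boundedly many further vertices.  Inner
-- vertices of a path dominate its first k vertices; these and the vertices of the
-- fans receive k out-neighbours outside E (fan vertices via non-fan ones), and
-- dually for in-neighbours.  Now delete fewer than k vertices from H.  One path
-- survives together with its two fans, every vertex still reaches the start of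
-- that path, and the end of that path still reaches every vertex.
module Submission where

open import Defs
open import Data.Empty using (⊥; ⊥-elim)
open import Data.Fin using (Fin; zero; suc; toℕ)
import Data.Fin.Properties as Fin
open import Data.Fin.Subset hiding (⊥)
import Data.Fin.Subset as Subset
open import Data.Fin.Subset.Properties
open import Data.List using (List; []; _∷_; _++_; length; map; concatMap; filter; allFin; foldr)
  renaming (tabulate to tabulateₗ)
open import Data.List.Properties using (length-++; length-tabulate; length-filter)
import Data.List.Membership.Propositional as List
open import Data.List.Membership.Propositional.Properties
  using (∈-++⁺ˡ; ∈-++⁺ʳ; ∈-++⁻; ∈-filter⁺; ∈-filter⁻; ∈-allFin; ∈-concatMap⁺)
import Data.List.Membership.DecPropositional as DecMembership
open import Data.List.Relation.Unary.All as All using (All; []; _∷_)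
import Data.List.Relation.Unary.All.Properties as All
open import Data.List.Relation.Unary.Any using (here; there)
open import Data.List.Relation.Unary.AllPairs using ([]; _∷_)
open import Data.List.Relation.Unary.Unique.Propositional using (Unique)
import Data.List.Relation.Unary.Unique.Propositional.Properties as Unique
open import Data.Nat
  using (ℕ; zero; suc; _+_; _*_; _∸_; _^_; _≤_; _<_; _≟_; >-nonZero; z≤n; s≤s; s≤s⁻¹; _≤?_; _<?_)
open import Data.Nat.Properties hiding (_≟_)
open import Data.Nat.ListAction using (sum)
open import Data.Nat.Logarithm using (⌈log₂_⌉; ⌈log₂⌉-mono-≤; ⌈log₂2^n⌉≡n)
open import Data.Nat.Solver using (module +-*-Solver)
open import Data.Product using (∃; ∃!; _×_; _,_; proj₁; proj₂)
open import Data.Sum using (_⊎_; inj₁; inj₂; [_,_]′)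
open import Data.Vec using (tabulate; _∷_; []; there)
open import Data.Vec.Properties using (lookup∘tabulate; lookup⇒[]=; []=⇒lookup)
open import Data.Vec.Properties.WithK using ([]=-irrelevant)
import Data.Unit as Unit
open import Function using (_∘_; id)
open import Level using (0ℓ)
open import Relation.Binary using (Rel; DecidableEquality; Tri; tri<; tri≈; tri>)
open import Relation.Binary.Construct.Closure.ReflexiveTransitive using (Star; ε; _◅_; _◅◅_; gmap; reverse)
open import Relation.Binary.PropositionalEquality using (_≡_; _≢_; refl; sym; trans; cong; subst)
open import Relation.Nullary using (¬_; Dec; yes; no; does; contradiction)
open import Relation.Nullary.Decidable using (dec-true; ¬?; _×-dec_; toWitness)
open import Relation.Unary using (Decidable)
open +-*-Solver using (solve; con; _:+_; _:*_; _:=_)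
open import Algebra.Properties.CommutativeSemigroup +-commutativeSemigroup using (x∙yz≈y∙xz)

-- Finite sets and counting

module _ {n : ℕ} where

  open DecMembership (Fin._≟_ {n}) public using () renaming (_∈?_ to _∈ₗ?_)

  ⟪_⟫ : {P : Fin n → Set} → Decidable P → Subset n
  ⟪ P? ⟫ = tabulate (does ∘ P?)

  ∈⟪⟫⁺ : {P : Fin n → Set} (P? : Decidable P) {x : Fin n} → P x → x ∈ ⟪ P? ⟫
  ∈⟪⟫⁺ P? {x} p = lookup⇒[]= x _ (trans (lookup∘tabulate _ x) (dec-true (P? x) p))

  ∈⟪⟫⁻ : {P : Fin n → Set} (P? : Decidable P) {x : Fin n} → x ∈ ⟪ P? ⟫ → P x
  ∈⟪⟫⁻ P? {x} x∈ with P? x | trans (sym (lookup∘tabulate (does ∘ P?) x)) ([]=⇒lookup x∈)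
  ... | yes p | _ = p
  ... | no _  | ()

  x∈p─q⁻ : (p q : Subset n) {x : Fin n} → x ∈ p ─ q → x ∈ p × x ∉ q
  x∈p─q⁻ p q {x} x∈ = p─q⊆p p q x∈ , λ x∈q → go p q x∈ x∈q
    where
    go : ∀ {m} (p q : Subset m) {x : Fin m} → x ∈ p ─ q → x ∉ q
    go (_ ∷ p) (outside ∷ q) (there i) (there j) = go p q i j
    go (_ ∷ p) (inside ∷ q)  (there i) (there j) = go p q i j

  fromList : List (Fin n) → Subset n
  fromList = foldr (λ x p → ⁅ x ⁆ ∪ p) Subset.⊥

  ∈-fromList⁺ : ∀ {x xs} → x List.∈ xs → x ∈ fromList xs
  ∈-fromList⁺ {xs = y ∷ xs} (here refl) = p⊆p∪q (fromList xs) (x∈⁅x⁆ y)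
  ∈-fromList⁺ {xs = y ∷ xs} (there i)   = q⊆p∪q ⁅ y ⁆ _ (∈-fromList⁺ i)

  ∈-fromList⁻ : ∀ {x} xs → x ∈ fromList xs → x List.∈ xs
  ∈-fromList⁻ []       x∈ = contradiction x∈ ∉⊥
  ∈-fromList⁻ (y ∷ xs) x∈ with x∈p∪q⁻ ⁅ y ⁆ (fromList xs) x∈
  ... | inj₁ i = here (x∈⁅y⁆⇒x≡y y i)
  ... | inj₂ i = there (∈-fromList⁻ xs i)

  elements : Subset n → List (Fin n)
  elements U = filter (_∈? U) (allFin n)

  ∈-elements⁺ : ∀ {x U} → x ∈ U → x List.∈ elements U
  ∈-elements⁺ {x} {U} x∈ = ∈-filter⁺ (_∈? U) (∈-allFin x) x∈

  ∈-elements⁻ : ∀ {x} U → x List.∈ elements U → x ∈ U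
  ∈-elements⁻ U x∈ = proj₂ (∈-filter⁻ (_∈? U) {xs = allFin n} x∈)

∣p∪q∣≤∣p∣+∣q∣ : ∀ {n} (p q : Subset n) → ∣ p ∪ q ∣ ≤ ∣ p ∣ + ∣ q ∣
∣p∪q∣≤∣p∣+∣q∣ []            []            = z≤n
∣p∪q∣≤∣p∣+∣q∣ (outside ∷ p) (outside ∷ q) = ∣p∪q∣≤∣p∣+∣q∣ p q
∣p∪q∣≤∣p∣+∣q∣ (outside ∷ p) (inside ∷ q)  =
  subst (suc ∣ p ∪ q ∣ ≤_) (sym (+-suc ∣ p ∣ ∣ q ∣)) (s≤s (∣p∪q∣≤∣p∣+∣q∣ p q))
∣p∪q∣≤∣p∣+∣q∣ (inside ∷ p)  (outside ∷ q) = s≤s (∣p∪q∣≤∣p∣+∣q∣ p q)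
∣p∪q∣≤∣p∣+∣q∣ (inside ∷ p)  (inside ∷ q)  =
  s≤s (≤-trans (∣p∪q∣≤∣p∣+∣q∣ p q) (+-monoʳ-≤ ∣ p ∣ (n≤1+n ∣ q ∣)))

module _ {n : ℕ} where

  ∣p∣≤∣p─q∣+∣q∣ : (p q : Subset n) → ∣ p ∣ ≤ ∣ p ─ q ∣ + ∣ q ∣
  ∣p∣≤∣p─q∣+∣q∣ p q = ≤-trans (p⊆q⇒∣p∣≤∣q∣ p⊆) (∣p∪q∣≤∣p∣+∣q∣ (p ─ q) q)
    where
    p⊆ : p ⊆ (p ─ q) ∪ q
    p⊆ {x} x∈p with x ∈? q
    ... | yes x∈q = q⊆p∪q (p ─ q) q x∈q
    ... | no x∉q  = p⊆p∪q q (x∈p∧x∉q⇒x∈p─q x∈p x∉q)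

  ∣p∣≤1+∣p-x∣ : (p : Subset n) (x : Fin n) → ∣ p ∣ ≤ suc ∣ p - x ∣
  ∣p∣≤1+∣p-x∣ p x = subst (∣ p ∣ ≤_)
    (trans (cong (∣ p - x ∣ +_) (∣⁅x⁆∣≡1 x)) (+-comm ∣ p - x ∣ 1)) (∣p∣≤∣p─q∣+∣q∣ p ⁅ x ⁆)

  ∣fromList∣≤ : ∀ xs → ∣ fromList {n} xs ∣ ≤ length xs
  ∣fromList∣≤ []       = ≤-reflexive (∣⊥∣≡0 n)
  ∣fromList∣≤ (x ∷ xs) = ≤-trans (∣p∪q∣≤∣p∣+∣q∣ ⁅ x ⁆ (fromList xs))
    (+-mono-≤ (≤-reflexive (∣⁅x⁆∣≡1 x)) (∣fromList∣≤ xs))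

  0<∣p∣⇒Nonempty : (p : Subset n) → 0 < ∣ p ∣ → Nonempty p
  0<∣p∣⇒Nonempty p 0<p with nonempty? p
  ... | yes q = q
  ... | no ¬q = contradiction (trans (cong ∣_∣ (Empty-unique ¬q)) (∣⊥∣≡0 n)) (>⇒≢ 0<p)

  unique-length≤ : ∀ {xs} {U : Subset n} → Unique xs → All (_∈ U) xs → length xs ≤ ∣ U ∣
  unique-length≤ [] [] = z≤n
  unique-length≤ {U = U} (x∉ ∷ uniq) (x∈ ∷ all) = ≤-trans
    (s≤s (unique-length≤ uniq (All.zipWith (λ (y∈ , x≢y) → x∈p∧x≢y⇒x∈p-y y∈ (x≢y ∘ sym)) (all , x∉))))
    (x∈p⇒∣p-x∣<∣p∣ x∈)

  length-elements : (U : Subset n) → length (elements U) ≤ ∣ U ∣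
  length-elements U = unique-length≤ (Unique.filter⁺ (_∈? U) (Unique.allFin⁺ n))
    (All.tabulate (∈-elements⁻ U))

  -- Counting by a list of distinct witnesses makes sense even when `P` is undecidable.
  AtLeast : ℕ → (Fin n → Set) → Set
  AtLeast m P = ∃ λ xs → Unique xs × length xs ≡ m × All P xs

  AtLeast-map : ∀ {m} {P Q : Fin n → Set} → (∀ {x} → P x → Q x) → AtLeast m P → AtLeast m Q
  AtLeast-map f (xs , u , l , a) = xs , u , l , All.map f a

  choose : ∀ m (U : Subset n) → m ≤ ∣ U ∣ → AtLeast m (_∈ U)
  choose zero    U _  = [] , [] , refl , []
  choose (suc m) U m< with 0<∣p∣⇒Nonempty U (≤-trans (s≤s z≤n) m<)
  ... | x , x∈ with choose m (U - x) (s≤s⁻¹ (≤-trans m< (∣p∣≤1+∣p-x∣ U x)))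
  ... | xs , u , l , a = x ∷ xs
    , All.map (λ y∈ x≡y → proj₂ (x∈p─q⁻ U ⁅ x ⁆ y∈) (subst (_∈ ⁅ x ⁆) x≡y (x∈⁅x⁆ x))) a ∷ u
    , cong suc l , x∈ ∷ All.map (λ y∈ → p─q⊆p U ⁅ x ⁆ y∈) a

  AtLeast-avoid : ∀ {m P} (D : Subset n) → ∣ D ∣ < m → AtLeast m P → ∃ λ x → P x × x ∉ D
  AtLeast-avoid {P = P} D D<m (xs , u , refl , a) = go xs a id
    where
    -- The function argument turns membership in `D` of the remaining entries into membership of all
    -- of `xs`; if no entry escapes, `D` has at least `m` elements.
    go : ∀ ys → All P ys → (All (_∈ D) ys → All (_∈ D) xs) → ∃ λ x → P x × x ∉ D
    go []       []        f = contradiction (unique-length≤ u (f [])) (<⇒≱ D<m)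
    go (y ∷ ys) (py ∷ ps) f with y ∈? D
    ... | yes y∈ = go ys ps (f ∘ (y∈ ∷_))
    ... | no y∉  = y , py , y∉

  -- Pigeonhole by induction on `m`: at most one element of `Q` takes the top value, and without it
  -- the values lie below the smaller bound.
  injective-below⇒∣∣≤ : (f : Fin n → ℕ) (Q : Subset n) (m : ℕ) →
    (∀ {x y} → x ∈ Q → y ∈ Q → f x ≡ f y → x ≡ y) → (∀ {x} → x ∈ Q → f x < m) → ∣ Q ∣ ≤ m
  injective-below⇒∣∣≤ f Q zero inj f< with 0 <? ∣ Q ∣
  ... | yes 0<Q = contradiction (f< (proj₂ (0<∣p∣⇒Nonempty Q 0<Q))) n≮0
  ... | no ¬0<Q = ≮⇒≥ ¬0<Q
  injective-below⇒∣∣≤ f Q (suc m) inj f< with Fin.any? (λ x → (x ∈? Q) ×-dec (f x ≟ m))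
  ... | yes (x , x∈ , fx≡m) = ≤-trans (∣p∣≤1+∣p-x∣ Q x)
    (s≤s (injective-below⇒∣∣≤ f (Q - x) m (λ y∈ z∈ → inj (p─q⊆p Q _ y∈) (p─q⊆p Q _ z∈)) below))
    where
    below : ∀ {y} → y ∈ Q - x → f y < m
    below {y} y∈ with x∈p─q⁻ Q ⁅ x ⁆ y∈
    ... | y∈Q , y∉x = ≤∧≢⇒< (s≤s⁻¹ (f< y∈Q))
      λ fy≡m → y∉x (subst (_∈ ⁅ x ⁆) (inj x∈ y∈Q (trans fx≡m (sym fy≡m))) (x∈⁅x⁆ x))
  ... | no none = m≤n⇒m≤1+n (injective-below⇒∣∣≤ f Q m inj
    λ {x} x∈ → ≤∧≢⇒< (s≤s⁻¹ (f< x∈)) (λ fx≡m → none (x , x∈ , fx≡m)))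

  argmin : (f : Fin n → ℕ) (U : Subset n) → Nonempty U →
           ∃ λ x → x ∈ U × (∀ {y} → y ∈ U → f x ≤ f y)
  argmin f U (x , x∈) = go (f x) x x∈ ≤-refl
    where
    -- The bound `b` on `f x` serves as fuel, since each better candidate lowers the value by at
    -- least one.
    go : ∀ b x → x ∈ U → f x ≤ b → ∃ λ x → x ∈ U × (∀ {y} → y ∈ U → f x ≤ f y)
    go b x x∈ fx≤b with Fin.any? (λ y → (y ∈? U) ×-dec (f y <? f x))
    ... | no none = x , x∈ , λ {y} y∈ → ≮⇒≥ λ fy<fx → none (y , y∈ , fy<fx)
    go zero    x x∈ fx≤b | yes (y , y∈ , fy<fx) = contradiction (≤-trans fy<fx fx≤b) n≮0
    go (suc b) x x∈ fx≤b | yes (y , y∈ , fy<fx) = go b y y∈ (s≤s⁻¹ (≤-trans fy<fx fx≤b))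

-- Walks, paths and connectivity

module _ {A : Set} {R : Rel A 0ℓ} (_≟_ : DecidableEquality A) where

  open DecMembership _≟_ using () renaming (_∈?_ to _∈ᵥ?_)

  path-from : ∀ {x u v} (w : Star R u v) → Unique (vertices w) → x List.∈ vertices w → Path R x v
  path-from ε       uniq       (here refl) = ε , uniq
  path-from (e ◅ w) uniq       (here refl) = e ◅ w , uniq
  path-from (e ◅ w) (_ ∷ uniq) (there i)   = path-from w uniq i

  -- Loop erasure: if the first vertex recurs later in the path, `path-from` keeps only the part
  -- from that recurrence on.
  walk⇒path : ∀ {u v} → Star R u v → Path R u v
  walk⇒path ε = ε , [] ∷ []
  walk⇒path (_◅_ {i} e w) with walk⇒path w
  ... | w′ , uniq with i ∈ᵥ? vertices w′
  ...   | yes i∈ = path-from w′ uniq i∈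
  ...   | no i∉  = e ◅ w′ , All.¬Any⇒All¬ _ i∉ ∷ uniq

op : ∀ {A} → Tournament A → Tournament A
op T = record
  { _⇒_          = λ u v → v ⇒ u
  ; trichotomous = λ u v → flip-tri (trichotomous u v)
  }
  where
  open Tournament T
  flip-tri : ∀ {u v} → Tri (u ⇒ v) (u ≡ v) (v ⇒ u) → Tri (v ⇒ u) (u ≡ v) (u ⇒ v)
  flip-tri (tri< a b c) = tri> c b a
  flip-tri (tri≈ a b c) = tri≈ c b a
  flip-tri (tri> a b c) = tri< c b a

module _ {n : ℕ} (T : Tournament (Fin n)) where

  open Tournament T

  _⇒?_ : ∀ u v → Dec (u ⇒ v)
  u ⇒? v with trichotomous u v
  ... | tri< a _ _ = yes a
  ... | tri≈ a _ _ = no a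
  ... | tri> a _ _ = no a

  irrefl : ∀ {u} → ¬ (u ⇒ u)
  irrefl {u} u⇒u with trichotomous u u
  ... | tri< _ b _ = b refl
  ... | tri≈ a _ _ = a u⇒u
  ... | tri> a _ _ = a u⇒u

  asym : ∀ {u v} → u ⇒ v → ¬ (v ⇒ u)
  asym {u} {v} u⇒v v⇒u with trichotomous u v
  ... | tri< _ _ c = c v⇒u
  ... | tri≈ _ _ c = c v⇒u
  ... | tri> a _ _ = a u⇒v

  reversed : ∀ {u v} → u ≢ v → ¬ (u ⇒ v) → v ⇒ u
  reversed {u} {v} u≢v ¬u⇒v with trichotomous u v
  ... | tri< a _ _ = contradiction a ¬u⇒v
  ... | tri≈ _ b _ = contradiction b u≢v
  ... | tri> _ _ c = c

  Out : Fin n → Subset n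
  Out u = ⟪ u ⇒?_ ⟫

  Step : Subset n → Rel (Fin n) 0ℓ
  Step U u v = u ∈ U × (u ⇒ v) × v ∈ U

  -- The empty walk exists at every vertex, also outside `U`; membership of the end vertices is
  -- therefore a hypothesis in `Strong`.
  Reach : Subset n → Rel (Fin n) 0ℓ
  Reach U = Star (Step U)

  Reach-mono : ∀ {U W u v} → U ⊆ W → Reach U u v → Reach W u v
  Reach-mono U⊆W = gmap id (λ (a , e , b) → U⊆W a , e , U⊆W b)

  Strong : Subset n → Set
  Strong U = ∀ {u v} → u ∈ U → v ∈ U → Reach U u v

  -- Strong `κ`-connectivity with walks in place of paths and with `S` not confined to `U`. The two
  -- conversions below show that it agrees with `StronglyKConnected`.
  Conn : ℕ → Subset n → Set
  Conn κ U = κ < ∣ U ∣ × (∀ S → ∣ S ∣ < κ → Strong (U ─ S))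

module _ {n : ℕ} {T : Tournament (Fin n)} where

  open Tournament T

  Conn-≤ : ∀ {κ λ′ U} → κ ≤ λ′ → Conn T λ′ U → Conn T κ U
  Conn-≤ κ≤ (size , strong) = ≤-<-trans κ≤ size , λ S S<κ → strong S (<-≤-trans S<κ κ≤)

  Conn-─ : ∀ {κ z U} Z → ∣ Z ∣ ≤ z → Conn T (κ + z) U → Conn T κ (U ─ Z)
  Conn-─ {κ} {z} {U} Z Z≤z (size , strong) =
      +-cancelʳ-< z κ ∣ U ─ Z ∣ (<-≤-trans size (≤-trans (∣p∣≤∣p─q∣+∣q∣ U Z) (+-monoʳ-≤ ∣ U ─ Z ∣ Z≤z)))
    , λ S S<κ → subst (Strong T) (sym (p─q─r≡p─q∪r U Z S))
        (strong (Z ∪ S) (≤-<-trans (∣p∪q∣≤∣p∣+∣q∣ Z S)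
          (subst (_< κ + z) (+-comm ∣ S ∣ ∣ Z ∣) (+-mono-<-≤ S<κ Z≤z))))

  Conn-op : ∀ {κ U} → Conn T κ U → Conn (op T) κ U
  Conn-op (size , strong) = size ,
    λ S S<κ u∈ v∈ → reverse (λ (a , e , b) → b , e , a) (strong S S<κ v∈ u∈)

  -- Replacing `S` by `S ∩ U` makes it an admissible set and removes the same vertices from `U`.
  StronglyKConnected⇒Conn : ∀ {κ U} → StronglyKConnected κ T U → Conn T κ U
  StronglyKConnected⇒Conn {κ} {U} (size , strong) = size , walk
    where
    walk : ∀ S → ∣ S ∣ < κ → Strong T (U ─ S)
    walk S S<κ {u} {v} u∈ v∈ = Reach-mono T out (gmap proj₁ (λ {a} {b} e → proj₂ a , e , proj₂ b)
      (proj₁ (strong (S ∩ U) (p∩q⊆q S U) (≤-<-trans (∣p∩q∣≤∣p∣ S U) S<κ) (u , into u∈) (v , into v∈))))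
      where
      into : U ─ S ⊆ U ─ (S ∩ U)
      into x∈ = x∈p∧x∉q⇒x∈p─q (p─q⊆p U S x∈) (proj₂ (x∈p─q⁻ U S x∈) ∘ proj₁ ∘ x∈p∩q⁻ S U)
      out : U ─ (S ∩ U) ⊆ U ─ S
      out x∈ with x∈p─q⁻ U (S ∩ U) x∈
      ... | x∈U , x∉ = x∈p∧x∉q⇒x∈p─q x∈U (λ x∈S → x∉ (x∈p∩q⁺ (x∈S , x∈U)))

  Conn⇒StronglyKConnected : ∀ {κ U} → Conn T κ U → StronglyKConnected κ T U
  Conn⇒StronglyKConnected {κ} {U} (size , strong) = size ,
    λ S _ S<κ (u , u∈) (v , v∈) → walk⇒path _≟ᵥ_ (lift u∈ v∈ (strong S S<κ u∈ v∈))
    where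
    _≟ᵥ_ : ∀ {W : Subset n} → DecidableEquality (∃ (_∈ W))
    (u , p) ≟ᵥ (v , q) with u Fin.≟ v
    ... | yes refl = yes (cong (u ,_) ([]=-irrelevant p q))
    ... | no u≢v   = no (u≢v ∘ cong proj₁)

    lift : ∀ {W u v} (p : u ∈ W) (q : v ∈ W) → Reach T W u v →
           Star (Tournament._⇒_ (T [ W ])) (u , p) (v , q)
    lift p q ε with refl ← []=-irrelevant p q = ε
    lift p q ((_ , e , r) ◅ w) = e ◅ lift r q w

-- Dominating sets

module _ {n : ℕ} (T : Tournament (Fin n)) where

  open Tournament T

  ∈Out∩⁺ : ∀ {U u v} → u ⇒ v → v ∈ U → v ∈ Out T u ∩ U
  ∈Out∩⁺ {u = u} u⇒v v∈ = x∈p∩q⁺ (∈⟪⟫⁺ (_⇒?_ T u) u⇒v , v∈)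

  ∈Out∩⁻ : ∀ {U u v} → v ∈ Out T u ∩ U → (u ⇒ v) × v ∈ U
  ∈Out∩⁻ {U} {u} v∈ with x∈p∩q⁻ (Out T u) U v∈
  ... | a , b = ∈⟪⟫⁻ (_⇒?_ T u) a , b

  -- If `v` had fewer than `κ` out-neighbours, deleting them would leave `v` unable to move,
  -- although more than `κ` vertices guarantee that a second vertex `w` remains.
  Conn⇒≤outdegree : ∀ {κ U v} → Conn T κ U → v ∈ U → κ ≤ ∣ Out T v ∩ U ∣
  Conn⇒≤outdegree {κ} {U} {v} (size , strong) v∈U = ≮⇒≥ λ d<κ →
    let S    = Out T v ∩ U
        v∈   = x∈p∧x∉q⇒x∈p─q v∈U (λ v∈S → irrefl T (proj₁ (∈Out∩⁻ v∈S)))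
        2≤   = +-cancelʳ-≤ (∣ S ∣) 2 _ (≤-trans (s≤s d<κ) (≤-trans size (∣p∣≤∣p─q∣+∣q∣ U S)))
        w , w∈ = 0<∣p∣⇒Nonempty (U ─ S - v) (s≤s⁻¹ (≤-trans 2≤ (∣p∣≤1+∣p-x∣ (U ─ S) v)))
        w∈U─S , w∉v = x∈p─q⁻ (U ─ S) ⁅ v ⁆ w∈
    in leave (λ v≡w → w∉v (subst (_∈ ⁅ v ⁆) v≡w (x∈⁅x⁆ v))) (strong S d<κ v∈ w∈U─S)
    where
    leave : ∀ {w} → v ≢ w → ¬ Reach T (U ─ (Out T v ∩ U)) v w
    leave v≢w ε = v≢w refl
    leave v≢w ((_ , e , x∈) ◅ _) with x∈p─q⁻ U (Out T v ∩ U) x∈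
    ... | x∈U , x∉ = x∉ (∈Out∩⁺ e x∈U)

module _ {A : Set} {R : Rel A 0ℓ} (R? : ∀ x y → Dec (R x y)) where

  private
    out in′ : List A → A → ℕ
    out ys x = length (filter (R? x) ys)
    in′ xs y = length (filter (λ x → R? x y) xs)

  sum-in-∷ : ∀ x xs ys → sum (map (in′ (x ∷ xs)) ys) ≡ out ys x + sum (map (in′ xs) ys)
  sum-in-∷ x xs [] = refl
  sum-in-∷ x xs (y ∷ ys) with ih ← sum-in-∷ x xs ys | R? x y
  ... | yes _ = cong suc (trans (cong (in′ xs y +_) ih) (x∙yz≈y∙xz (in′ xs y) (out ys x) _))
  ... | no _  = trans (cong (in′ xs y +_) ih) (x∙yz≈y∙xz (in′ xs y) (out ys x) _)

  -- Both sides count the related pairs, by rows and by columns.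
  double-counting : ∀ xs ys → sum (map (out ys) xs) ≡ sum (map (in′ xs) ys)
  double-counting [] ys = sym (zeros ys)
    where
    zeros : ∀ ys → sum (map (in′ []) ys) ≡ 0
    zeros []       = refl
    zeros (_ ∷ ys) = zeros ys
  double-counting (x ∷ xs) ys =
    trans (cong (out ys x +_) (double-counting xs ys)) (sym (sum-in-∷ x xs ys))

sum-≤⇒some-≤ : ∀ {A : Set} (f g : A → ℕ) z zs →
  sum (map f (z ∷ zs)) ≤ sum (map g (z ∷ zs)) → ∃ λ x → x List.∈ z ∷ zs × f x ≤ g x
sum-≤⇒some-≤ f g z zs le with f z ≤? g z
... | yes p = z , here refl , p
sum-≤⇒some-≤ f g z [] le | no ¬p = contradiction (+-cancelʳ-≤ 0 _ _ le) ¬p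
sum-≤⇒some-≤ f g z (z′ ∷ zs) le | no ¬p
  with sum-≤⇒some-≤ f g z′ zs
    (≮⇒≥ λ lt → <⇒≱ (+-mono-< (≰⇒> ¬p) lt) le)
... | x , x∈ , p = x , there x∈ , p

module _ {n : ℕ} (T : Tournament (Fin n)) where

  open Tournament T

  -- Within `C` the out-degrees and the in-degrees have the same sum, so some vertex has out-degree
  -- at most its in-degree; the two together are at most the size of `C`.
  half-outdegree : ∀ C → Nonempty C → ∃ λ x → x ∈ C × 2 * ∣ Out T x ∩ C ∣ ≤ ∣ C ∣
  half-outdegree C (c , c∈) = go (elements C) refl (∈-elements⁺ c∈)
    where
    out in′ : Fin n → List (Fin n)
    out x = filter (_⇒?_ T x) (elements C)
    in′ x = filter (λ y → _⇒?_ T y x) (elements C)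

    elements! : Unique (elements C)
    elements! = Unique.filter⁺ (_∈? C) (Unique.allFin⁺ n)

    out+in≤ : ∀ x → length (out x) + length (in′ x) ≤ ∣ C ∣
    out+in≤ x = subst (_≤ ∣ C ∣) (length-++ (out x)) (unique-length≤
      (Unique.++⁺ (Unique.filter⁺ (_⇒?_ T x) elements!) (Unique.filter⁺ (λ y → _⇒?_ T y x) elements!)
        (λ (a , b) → asym T (proj₂ (∈-filter⁻ (_⇒?_ T x) {xs = elements C} a))
                            (proj₂ (∈-filter⁻ (λ y → _⇒?_ T y x) {xs = elements C} b))))
      (All.++⁺ (All.tabulate (∈-elements⁻ C ∘ proj₁ ∘ ∈-filter⁻ (_⇒?_ T x)))
               (All.tabulate (∈-elements⁻ C ∘ proj₁ ∘ ∈-filter⁻ (λ y → _⇒?_ T y x)))))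

    ∣Out∩C∣≤ : ∀ x → ∣ Out T x ∩ C ∣ ≤ length (out x)
    ∣Out∩C∣≤ x = ≤-trans (p⊆q⇒∣p∣≤∣q∣ into) (∣fromList∣≤ (out x))
      where
      into : Out T x ∩ C ⊆ fromList (out x)
      into y∈ with ∈Out∩⁻ T y∈
      ... | x⇒y , y∈C = ∈-fromList⁺ (∈-filter⁺ (_⇒?_ T x) (∈-elements⁺ y∈C) x⇒y)

    go : ∀ zs → zs ≡ elements C → c List.∈ zs → ∃ λ x → x ∈ C × 2 * ∣ Out T x ∩ C ∣ ≤ ∣ C ∣
    go (z ∷ zs) eq _ with sum-≤⇒some-≤ (length ∘ out) (length ∘ in′) z zs
      (subst (λ ws → sum (map (length ∘ out) ws) ≤ sum (map (length ∘ in′) ws)) (sym eq)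
        (≤-reflexive (double-counting (_⇒?_ T) (elements C) (elements C))))
    ... | x , x∈ , out≤in = x , ∈-elements⁻ C (subst (x List.∈_) eq x∈) ,
      ≤-trans (+-mono-≤ (∣Out∩C∣≤ x) (≤-trans (≤-reflexive (+-identityʳ _)) (≤-trans (∣Out∩C∣≤ x) out≤in)))
              (out+in≤ x)

  -- Here `c` is the number of halving rounds and `d` the out-degree of the first vertex. Each round
  -- adds at most one member, which becomes the root, and at least halves the exceptional set of
  -- common out-neighbours.
  record Fan (U : Subset n) (c d : ℕ) : Set where
    field
      members      : List (Fin n)
      root         : Fin n
      exceptional  : Subset n
      size         : length members ≤ suc c
      members⊆     : ∀ {x} → x List.∈ members → x ∈ U
      root∈        : root List.∈ members
      to-root      : ∀ {x} → x List.∈ members → root ≡ x ⊎ x ⇒ root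
      common       : ∀ {x y} → x List.∈ members → y ∈ exceptional → x ⇒ y
      exceptional⊆ : exceptional ⊆ U
      dominated    : ∀ {v} → v ∈ U → v List.∉ members → v ∉ exceptional →
                     ∃ λ x → x List.∈ members × v ⇒ x
      few          : 2 ^ c * ∣ exceptional ∣ ≤ d

  -- A new vertex `x` is taken from the exceptional set, so all earlier members dominate it and it
  -- can be the root. Other exceptional vertices that `x` does not dominate send an arc to `x` and
  -- cease to be exceptional.
  fan : ∀ {U a} → a ∈ U → ∀ c → Fan U c ∣ Out T a ∩ U ∣
  fan {U} {a} a∈ zero = record
    { members      = a ∷ []
    ; root         = a
    ; exceptional  = Out T a ∩ U
    ; size         = ≤-refl
    ; members⊆     = λ { (here refl) → a∈ }
    ; root∈        = here refl
    ; to-root      = λ { (here refl) → inj₁ refl }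
    ; common       = λ { (here refl) y∈ → proj₁ (∈Out∩⁻ T y∈) }
    ; exceptional⊆ = proj₂ ∘ ∈Out∩⁻ T
    ; dominated    = λ v∈ v∉ v∉E → a , here refl ,
        reversed T (λ a≡v → v∉ (here (sym a≡v))) (λ a⇒v → v∉E (∈Out∩⁺ T a⇒v v∈))
    ; few          = ≤-reflexive (+-identityʳ _)
    }
  fan {U} {a} a∈ (suc c) with fan a∈ c
  ... | F with nonempty? (Fan.exceptional F)
  -- With nothing exceptional left, the fan stays as it is and both bounds persist.
  ...   | no ¬E = record
    { Fan F
    ; size = m≤n⇒m≤1+n (Fan.size F)
    ; few  = subst (λ e → 2 ^ suc c * e ≤ _)
        (sym (trans (cong ∣_∣ (Empty-unique ¬E)) (∣⊥∣≡0 n)))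
        (≤-trans (≤-reflexive (*-zeroʳ (2 ^ suc c))) z≤n)
    }
  ...   | yes E≠∅ with half-outdegree (Fan.exceptional F) E≠∅
  ...     | x , x∈ , half = record
    { members      = x ∷ members
    ; root         = x
    ; exceptional  = Out T x ∩ exceptional
    ; size         = s≤s size
    ; members⊆     = λ { (here refl) → exceptional⊆ x∈ ; (there i) → members⊆ i }
    ; root∈        = here refl
    ; to-root      = λ { (here refl) → inj₁ refl ; (there i) → inj₂ (common i x∈) }
    ; common       = λ { (here refl) y∈ → proj₁ (∈Out∩⁻ T y∈)
                       ; (there i) y∈ → common i (proj₂ (∈Out∩⁻ T y∈)) }
    ; exceptional⊆ = exceptional⊆ ∘ proj₂ ∘ ∈Out∩⁻ T
    ; dominated    = dominated′
    ; few          = ≤-trans (≤-reflexive (trans (cong (_* ∣ Out T x ∩ exceptional ∣) (*-comm 2 (2 ^ c)))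
                                                 (*-assoc (2 ^ c) 2 _)))
                             (≤-trans (*-monoʳ-≤ (2 ^ c) half) few)
    }
    where
    open Fan F
    dominated′ : ∀ {v} → v ∈ U → v List.∉ x ∷ members → v ∉ Out T x ∩ exceptional →
                 ∃ λ y → y List.∈ x ∷ members × v ⇒ y
    dominated′ {v} v∈ v∉ v∉E with v ∈? exceptional
    ... | yes v∈E = x , here refl ,
      reversed T (λ x≡v → v∉ (here (sym x≡v))) (λ x⇒v → v∉E (∈Out∩⁺ T x⇒v v∈E))
    ... | no v∉E′ with dominated v∈ (v∉ ∘ there) v∉E′
    ...   | y , y∈ , v⇒y = y , there y∈ , v⇒y

  -- m disjoint fans at once: anchor sends each member to the root of its fan
  -- and fixes all other vertices.
  record Fans (U : Subset n) (m c : ℕ) : Set where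
    field
      low          : List (Fin n)
      roots        : Subset n
      anchor       : Fin n → Fin n
      exceptional  : Subset n
      size         : length low ≤ m * suc c
      m≤∣roots∣    : m ≤ ∣ roots ∣
      low⊆         : ∀ {x} → x List.∈ low → x ∈ U
      roots⊆       : ∀ {x} → x ∈ roots → x List.∈ low
      anchor-root  : ∀ {x} → x ∈ roots → anchor x ≡ x
      anchor-low   : ∀ {x} → x List.∈ low → anchor x ∈ roots
      anchor-other : ∀ {x} → x List.∉ low → anchor x ≡ x
      to-anchor    : ∀ {x} → x List.∈ low → anchor x ≡ x ⊎ x ⇒ anchor x
      dominated    : ∀ {v s} → v ∈ U → v List.∉ low → v ∉ exceptional → s ∈ roots →
                     ∃ λ x → x List.∈ low × anchor x ≡ s × v ⇒ x
      few          : ∀ {v} → v ∈ U → v List.∉ low →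
                     2 ^ c * ∣ exceptional ∣ ≤ m * ∣ Out T v ∩ U ∣

  fans : ∀ U m c → m * suc c ≤ ∣ U ∣ → Fans U m c
  fans U zero c _ = record
    { low          = []
    ; roots        = Subset.⊥
    ; anchor       = id
    ; exceptional  = Subset.⊥
    ; size         = z≤n
    ; m≤∣roots∣    = z≤n
    ; low⊆         = λ ()
    ; roots⊆       = λ x∈ → contradiction x∈ ∉⊥
    ; anchor-root  = λ _ → refl
    ; anchor-low   = λ ()
    ; anchor-other = λ _ → refl
    ; to-anchor    = λ ()
    ; dominated    = λ _ _ _ s∈ → contradiction s∈ ∉⊥
    ; few          = λ _ _ → ≤-reflexive (trans (cong (2 ^ c *_) (∣⊥∣≡0 n)) (*-zeroʳ (2 ^ c)))
    }
  -- Starting at a vertex of minimum out-degree in `U` bounds the exceptional set by the out-degree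
  -- of every vertex of `U`. The next fans are built in `U′`, where out-degrees are no larger than
  -- in `U`.
  fans U (suc m) c le with argmin (λ v → ∣ Out T v ∩ U ∣) U (0<∣p∣⇒Nonempty U (≤-trans (s≤s z≤n) le))
  ... | a , a∈ , a-min = record
    { low          = F.members ++ Fs.low
    ; roots        = ⁅ F.root ⁆ ∪ Fs.roots
    ; anchor       = anchor
    ; exceptional  = F.exceptional ∪ Fs.exceptional
    ; size         = subst (_≤ suc m * suc c) (sym (length-++ F.members)) (+-mono-≤ F.size Fs.size)
    ; m≤∣roots∣    = ≤-<-trans Fs.m≤∣roots∣ (p⊂q⇒∣p∣<∣q∣
        (q⊆p∪q ⁅ F.root ⁆ Fs.roots , F.root , p⊆p∪q Fs.roots (x∈⁅x⁆ F.root)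
        , λ r∈ → later∉ (Fs.roots⊆ r∈) F.root∈))
    ; low⊆         = [ F.members⊆ , p─q⊆p U _ ∘ Fs.low⊆ ]′ ∘ ∈-++⁻ F.members
    ; roots⊆       = [ ∈-++⁺ˡ ∘ root∈ , ∈-++⁺ʳ F.members ∘ Fs.roots⊆ ]′ ∘ x∈p∪q⁻ ⁅ F.root ⁆ Fs.roots
    ; anchor-root  = λ x∈ → anchor-root (x∈p∪q⁻ ⁅ F.root ⁆ Fs.roots x∈)
    ; anchor-low   = λ x∈ → anchor-low (∈-++⁻ F.members x∈)
    ; anchor-other = anchor-other
    ; to-anchor    = λ x∈ → to-anchor (∈-++⁻ F.members x∈)
    ; dominated    = dominated
    ; few          = few
    }
    where
    module F = Fan (fan a∈ c)
    U′ = U ─ fromList F.members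
    U′-large : m * suc c ≤ ∣ U′ ∣
    U′-large = +-cancelˡ-≤ (suc c) _ _ (≤-trans le (≤-trans (∣p∣≤∣p─q∣+∣q∣ U (fromList F.members))
      (≤-trans (+-monoʳ-≤ ∣ U′ ∣ (≤-trans (∣fromList∣≤ F.members) F.size))
               (≤-reflexive (+-comm ∣ U′ ∣ (suc c))))))
    module Fs = Fans (fans U′ m c U′-large)

    anchor : Fin n → Fin n
    anchor x with x ∈ₗ? F.members
    ... | yes _ = F.root
    ... | no _  = Fs.anchor x

    later∉ : ∀ {x} → x List.∈ Fs.low → x List.∉ F.members
    later∉ x∈ x∈F = proj₂ (x∈p─q⁻ U (fromList F.members) (Fs.low⊆ x∈)) (∈-fromList⁺ x∈F)

    root∈ : ∀ {x} → x ∈ ⁅ F.root ⁆ → x List.∈ F.members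
    root∈ x∈ = subst (List._∈ F.members) (sym (x∈⁅y⁆⇒x≡y F.root x∈)) F.root∈

    anchor-here : ∀ {x} → x List.∈ F.members → anchor x ≡ F.root
    anchor-here {x} x∈ with x ∈ₗ? F.members
    ... | yes _ = refl
    ... | no x∉ = contradiction x∈ x∉

    anchor-there : ∀ {x} → x List.∉ F.members → anchor x ≡ Fs.anchor x
    anchor-there {x} x∉ with x ∈ₗ? F.members
    ... | yes x∈ = contradiction x∈ x∉
    ... | no _   = refl

    anchor-root : ∀ {x} → x ∈ ⁅ F.root ⁆ ⊎ x ∈ Fs.roots → anchor x ≡ x
    anchor-root (inj₁ x∈) = trans (anchor-here (root∈ x∈)) (sym (x∈⁅y⁆⇒x≡y F.root x∈))
    anchor-root (inj₂ x∈) = trans (anchor-there (later∉ (Fs.roots⊆ x∈))) (Fs.anchor-root x∈)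

    anchor-low : ∀ {x} → x List.∈ F.members ⊎ x List.∈ Fs.low → anchor x ∈ ⁅ F.root ⁆ ∪ Fs.roots
    anchor-low (inj₁ x∈) = p⊆p∪q Fs.roots (subst (_∈ ⁅ F.root ⁆) (sym (anchor-here x∈)) (x∈⁅x⁆ F.root))
    anchor-low (inj₂ x∈) = q⊆p∪q ⁅ F.root ⁆ Fs.roots
      (subst (_∈ Fs.roots) (sym (anchor-there (later∉ x∈))) (Fs.anchor-low x∈))

    anchor-other : ∀ {x} → x List.∉ F.members ++ Fs.low → anchor x ≡ x
    anchor-other x∉ = trans (anchor-there (x∉ ∘ ∈-++⁺ˡ)) (Fs.anchor-other (x∉ ∘ ∈-++⁺ʳ F.members))

    to-anchor : ∀ {x} → x List.∈ F.members ⊎ x List.∈ Fs.low → anchor x ≡ x ⊎ x ⇒ anchor x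
    to-anchor {x} (inj₁ x∈) = subst (λ r → r ≡ x ⊎ x ⇒ r) (sym (anchor-here x∈)) (F.to-root x∈)
    to-anchor {x} (inj₂ x∈) = subst (λ r → r ≡ x ⊎ x ⇒ r) (sym (anchor-there (later∉ x∈))) (Fs.to-anchor x∈)

    stays : ∀ {v} → v ∈ U → v List.∉ F.members ++ Fs.low → v ∈ U′
    stays v∈ v∉ = x∈p∧x∉q⇒x∈p─q v∈ (v∉ ∘ ∈-++⁺ˡ ∘ ∈-fromList⁻ F.members)

    dominated : ∀ {v s} → v ∈ U → v List.∉ F.members ++ Fs.low → v ∉ F.exceptional ∪ Fs.exceptional →
                s ∈ ⁅ F.root ⁆ ∪ Fs.roots → ∃ λ x → x List.∈ F.members ++ Fs.low × anchor x ≡ s × v ⇒ x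
    dominated v∈ v∉ v∉E s∈ with x∈p∪q⁻ ⁅ F.root ⁆ Fs.roots s∈
    ... | inj₁ s∈F with F.dominated v∈ (v∉ ∘ ∈-++⁺ˡ) (v∉E ∘ p⊆p∪q Fs.exceptional)
    ...   | x , x∈ , v⇒x = x , ∈-++⁺ˡ x∈ , trans (anchor-here x∈) (sym (x∈⁅y⁆⇒x≡y F.root s∈F)) , v⇒x
    dominated v∈ v∉ v∉E s∈ | inj₂ s∈Fs with Fs.dominated (stays v∈ v∉) (v∉ ∘ ∈-++⁺ʳ F.members)
                                            (v∉E ∘ q⊆p∪q F.exceptional Fs.exceptional) s∈Fs
    ...   | x , x∈ , eq , v⇒x = x , ∈-++⁺ʳ F.members x∈ , trans (anchor-there (later∉ x∈)) eq , v⇒x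

    few : ∀ {v} → v ∈ U → v List.∉ F.members ++ Fs.low →
          2 ^ c * ∣ F.exceptional ∪ Fs.exceptional ∣ ≤ suc m * ∣ Out T v ∩ U ∣
    few {v} v∈ v∉ = begin
      2 ^ c * ∣ F.exceptional ∪ Fs.exceptional ∣
        ≤⟨ *-monoʳ-≤ (2 ^ c) (∣p∪q∣≤∣p∣+∣q∣ F.exceptional Fs.exceptional) ⟩
      2 ^ c * (∣ F.exceptional ∣ + ∣ Fs.exceptional ∣)
        ≡⟨ *-distribˡ-+ (2 ^ c) ∣ F.exceptional ∣ ∣ Fs.exceptional ∣ ⟩
      2 ^ c * ∣ F.exceptional ∣ + 2 ^ c * ∣ Fs.exceptional ∣
        ≤⟨ +-mono-≤ (≤-trans F.few (a-min v∈)) (Fs.few (stays v∈ v∉) (v∉ ∘ ∈-++⁺ʳ F.members)) ⟩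
      ∣ Out T v ∩ U ∣ + m * ∣ Out T v ∩ U′ ∣
        ≤⟨ +-monoʳ-≤ ∣ Out T v ∩ U ∣ (*-monoʳ-≤ m (p⊆q⇒∣p∣≤∣q∣ shrink)) ⟩
      suc m * ∣ Out T v ∩ U ∣ ∎
      where
      open ≤-Reasoning
      shrink : Out T v ∩ U′ ⊆ Out T v ∩ U
      shrink x∈ with ∈Out∩⁻ T x∈
      ... | e , x∈U′ = ∈Out∩⁺ T e (p─q⊆p U _ x∈U′)

-- Geodesics

module _ {n : ℕ} (T : Tournament (Fin n)) where

  open Tournament T

  -- The set `X` of vertices known to be reachable grows by the head of a crossing arc until it
  -- contains `v`. As `X` stays inside `W`, this happens before the fuel `m` runs out.
  uncut⇒Reach : ∀ W {u v} → u ∈ W →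
    (∀ X → X ⊆ W → u ∈ X → v ∉ X → ∃ λ x → ∃ λ y → x ∈ X × (y ∈ W × y ∉ X) × x ⇒ y) →
    Reach T W u v
  uncut⇒Reach W {u} {v} u∈ crossing = go ∣ W ∣ ⁅ u ⁆
      (λ x∈ → subst (_∈ W) (sym (x∈⁅y⁆⇒x≡y u x∈)) u∈) (x∈⁅x⁆ u)
      (λ x∈ → subst (Reach T W u) (sym (x∈⁅y⁆⇒x≡y u x∈)) ε)
      (≤-reflexive (cong (_+ ∣ W ∣) (sym (∣⁅x⁆∣≡1 u))))
    where
    go : ∀ m X → X ⊆ W → u ∈ X → (∀ {x} → x ∈ X → Reach T W u x) → ∣ W ∣ < ∣ X ∣ + m → Reach T W u v
    go m X X⊆ u∈X reach lt with v ∈? X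
    ... | yes v∈ = reach v∈
    go zero X X⊆ u∈X reach lt | no v∉ =
      contradiction (p⊆q⇒∣p∣≤∣q∣ X⊆) (<⇒≱ (subst (∣ W ∣ <_) (+-identityʳ _) lt))
    go (suc m) X X⊆ u∈X reach lt | no v∉ with crossing X X⊆ u∈X v∉
    ... | x , y , x∈ , (y∈ , y∉) , x⇒y = go m (⁅ y ⁆ ∪ X)
      (λ z∈ → [ (λ z∈y → subst (_∈ W) (sym (x∈⁅y⁆⇒x≡y y z∈y)) y∈) , X⊆ ]′ (x∈p∪q⁻ ⁅ y ⁆ X z∈))
      (q⊆p∪q ⁅ y ⁆ X u∈X)
      (λ z∈ → [ (λ z∈y → subst (Reach T W u) (sym (x∈⁅y⁆⇒x≡y y z∈y)) (reach x∈ ◅◅ (X⊆ x∈ , x⇒y , y∈) ◅ ε))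
              , reach ]′ (x∈p∪q⁻ ⁅ y ⁆ X z∈))
      (<-≤-trans lt (≤-trans (≤-reflexive (+-suc ∣ X ∣ m))
        (+-monoˡ-≤ m (p⊂q⇒∣p∣<∣q∣ (q⊆p∪q ⁅ y ⁆ X , y , p⊆p∪q X (x∈⁅x⁆ y) , y∉)))))

  injective-between⇒∣∣≤ : (f : Fin n → ℕ) (Q : Subset n) (a m : ℕ) →
    (∀ {x y} → x ∈ Q → y ∈ Q → f x ≡ f y → x ≡ y) → (∀ {x} → x ∈ Q → a ≤ f x) →
    (∀ {x} → x ∈ Q → f x < a + m) → ∣ Q ∣ ≤ m
  injective-between⇒∣∣≤ f Q a m inj a≤ f< = injective-below⇒∣∣≤ (λ x → f x ∸ a) Q m
    (λ x∈ y∈ eq → inj x∈ y∈ (∸-cancelʳ-≡ (a≤ x∈) (a≤ y∈) eq))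
    (λ {x} x∈ → +-cancelˡ-< a _ _ (subst (_< a + m) (sym (m+[n∸m]≡n (a≤ x∈))) (f< x∈)))

  -- If no arc leaves X for Y then Y ⇒ X, so p ⇒ y ⇒ x ⇒ q shows that the level
  -- rises by at most 3 from a vertex p of P with an arc to Y to a vertex q of P
  -- with an arc from X.  Hence four vertices of P block every route through P.
  module _ {G P : Subset n} (lev : Fin n → ℕ) (P⊆G : P ⊆ G)
    (lipschitz : ∀ {u v} → u ∈ G → v ∈ G → u ⇒ v → lev v ≤ suc (lev u))
    (injective : ∀ {p q} → p ∈ P → q ∈ P → lev p ≡ lev q → p ≡ q) where

    private
      module Cut {κ} (conn : Conn T (κ + 4) G) (S : Subset n) (S<κ : ∣ S ∣ < κ)
        {u v} (v∈ : v ∈ G ─ P ─ S) (X : Subset n) (X⊆ : X ⊆ G ─ P ─ S) (u∈X : u ∈ X) (v∉X : v ∉ X)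
        (uncrossed : ∀ {x y} → x ∈ X → y ∈ G ─ P ─ S → y ∉ X → ¬ (x ⇒ y)) where

        W = G ─ P ─ S

        W⁻ : ∀ {x} → x ∈ W → x ∈ G × x ∉ P × x ∉ S
        W⁻ x∈ with x∈p─q⁻ (G ─ P) S x∈
        ... | x∈′ , x∉S with x∈p─q⁻ G P x∈′
        ... | x∈G , x∉P = x∈G , x∉P , x∉S

        back : ∀ {x y} → x ∈ X → y ∈ W → y ∉ X → y ⇒ x
        back x∈ y∈ y∉ = reversed T (λ { refl → y∉ x∈ }) (uncrossed x∈ y∈ y∉)

        -- `M` is the part of `P` to be deleted and `Lo` describes the vertices of `P` that can be
        -- entered. A walk from `X` avoiding `S ∪ M` stays in `X` or in `Lo`, so it never reaches
        -- `v`; but `S ∪ M` has fewer than `κ + 4` vertices.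
        module Trap (M : Subset n) (M≤4 : ∣ M ∣ ≤ 4) (M⊆P : M ⊆ P) (Lo : Fin n → Set)
          (X⇒Lo  : ∀ {x p} → x ∈ X → p ∈ P → p ∉ M → x ⇒ p → Lo p)
          (Lo⇒Lo : ∀ {p q} → p ∈ P → Lo p → q ∈ P → q ∉ M → p ⇒ q → Lo q)
          (Lo⇏Y  : ∀ {p y} → p ∈ P → Lo p → y ∈ W → y ∉ X → ¬ (p ⇒ y)) where

          trapped : ∀ {a b} → a ∈ X ⊎ (a ∈ P × Lo a) → Reach T (G ─ (S ∪ M)) a b → b ∈ X ⊎ (b ∈ P × Lo b)
          trapped i ε = i
          trapped {a} i (_◅_ {j = z} (_ , e , z∈) w) = trapped (next i) w
            where
            z∈G : z ∈ G
            z∈G = p─q⊆p G _ z∈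
            z∉ : z ∉ S ∪ M
            z∉ = proj₂ (x∈p─q⁻ G (S ∪ M) z∈)
            z∉M : z ∉ M
            z∉M = z∉ ∘ q⊆p∪q S M
            next : a ∈ X ⊎ (a ∈ P × Lo a) → z ∈ X ⊎ (z ∈ P × Lo z)
            next i with z ∈? P
            next (inj₁ a∈X)       | yes z∈P = inj₂ (z∈P , X⇒Lo a∈X z∈P z∉M e)
            next (inj₂ (a∈P , l)) | yes z∈P = inj₂ (z∈P , Lo⇒Lo a∈P l z∈P z∉M e)
            next i                | no z∉P with z ∈? X
            ... | yes z∈X = inj₁ z∈X
            ... | no z∉X with i | x∈p∧x∉q⇒x∈p─q (x∈p∧x∉q⇒x∈p─q z∈G z∉P) (z∉ ∘ p⊆p∪q M)
            ...   | inj₁ a∈X       | z∈W = contradiction e (uncrossed a∈X z∈W z∉X)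
            ...   | inj₂ (a∈P , l) | z∈W = contradiction e (Lo⇏Y a∈P l z∈W z∉X)

          alive : ∀ {x} → x ∈ W → x ∈ G ─ (S ∪ M)
          alive x∈ with W⁻ x∈
          ... | x∈G , x∉P , x∉S = x∈p∧x∉q⇒x∈p─q x∈G ([ x∉S , x∉P ∘ M⊆P ]′ ∘ x∈p∪q⁻ S M)

          impossible : ⊥
          impossible with trapped (inj₁ u∈X) (proj₂ conn (S ∪ M)
            (≤-<-trans (∣p∪q∣≤∣p∣+∣q∣ S M) (+-mono-<-≤ S<κ M≤4)) (alive (X⊆ u∈X)) (alive v∈))
          ... | inj₁ v∈X       = v∉X v∈X
          ... | inj₂ (v∈P , _) = proj₁ (proj₂ (W⁻ v∈)) v∈P

        sends? : Decidable (λ p → p ∈ P × ∃ λ y → (y ∈ W × y ∉ X) × p ⇒ y)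
        sends? p = p ∈? P ×-dec Fin.any? (λ y → (y ∈? W ×-dec ¬? (y ∈? X)) ×-dec _⇒?_ T p y)

        ⊥-cut : ⊥
        ⊥-cut with nonempty? ⟪ sends? ⟫
        -- No vertex of `P` sends an arc to the far side, so nothing of `P` need be deleted and all
        -- of it may count as `Lo`.
        ... | no none = Trap.impossible Subset.⊥ (≤-trans (≤-reflexive (∣⊥∣≡0 n)) z≤n)
          (λ x∈ → contradiction x∈ ∉⊥) (λ _ → Unit.⊤)
          _ _ (λ p∈ _ y∈ y∉ p⇒y → none (_ , ∈⟪⟫⁺ sends? (p∈ , _ , (y∈ , y∉) , p⇒y)))
        -- Let `a` be a vertex of lowest level in `P` with an arc to the far side. The vertices of
        -- `P` below `a` form `Lo`, and the four levels starting at `lev a` form the window `M`.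
        ... | yes some with argmin lev ⟪ sends? ⟫ some
        ...   | a , a∈ , a-min with ∈⟪⟫⁻ sends? a∈
        ...   | a∈P , b , (b∈ , b∉) , a⇒b = Trap.impossible M M≤4 (λ x∈ → proj₁ (∈⟪⟫⁻ mid? x∈))
              (λ p → lev p < lev a) X⇒Lo Lo⇒Lo
              (λ p∈ lo y∈ y∉ p⇒y → <⇒≱ lo (a-min (∈⟪⟫⁺ sends? (p∈ , _ , (y∈ , y∉) , p⇒y))))
          where
          mid? : Decidable (λ p → p ∈ P × (lev a ≤ lev p × lev p < lev a + 4))
          mid? p = p ∈? P ×-dec (lev a ≤? lev p ×-dec lev p <? lev a + 4)
          M = ⟪ mid? ⟫
          M≤4 : ∣ M ∣ ≤ 4
          M≤4 = injective-between⇒∣∣≤ lev M (lev a) 4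
            (λ x∈ y∈ → injective (proj₁ (∈⟪⟫⁻ mid? x∈)) (proj₁ (∈⟪⟫⁻ mid? y∈)))
            (λ x∈ → proj₁ (proj₂ (∈⟪⟫⁻ mid? x∈))) (λ x∈ → proj₂ (proj₂ (∈⟪⟫⁻ mid? x∈)))
          below : ∀ {p} → p ∈ P → p ∉ M → lev p ≤ lev a + 3 → lev p < lev a
          below p∈ p∉ le = ≰⇒> λ ge →
            p∉ (∈⟪⟫⁺ mid? (p∈ , ge , ≤-trans (s≤s le) (≤-reflexive (sym (+-suc (lev a) 3)))))
          X⇒Lo : ∀ {x p} → x ∈ X → p ∈ P → p ∉ M → x ⇒ p → lev p < lev a
          -- The walk `a`, `b`, `x`, `p` rises by at most three levels, so `p` lies in the window or
          -- below `a`.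
          X⇒Lo {x} {p} x∈ p∈ p∉ x⇒p = below p∈ p∉ (begin
            lev p       ≤⟨ lipschitz x∈G (P⊆G p∈) x⇒p ⟩
            1 + lev x   ≤⟨ s≤s (lipschitz (proj₁ (W⁻ b∈)) x∈G (back x∈ b∈ b∉)) ⟩
            2 + lev b   ≤⟨ s≤s (s≤s (lipschitz (P⊆G a∈P) (proj₁ (W⁻ b∈)) a⇒b)) ⟩
            3 + lev a   ≡⟨ +-comm 3 (lev a) ⟩
            lev a + 3   ∎)
            where
            open ≤-Reasoning
            x∈G = proj₁ (W⁻ (X⊆ x∈))
          Lo⇒Lo : ∀ {p q} → p ∈ P → lev p < lev a → q ∈ P → q ∉ M → p ⇒ q → lev q < lev a
          Lo⇒Lo p∈ lo q∈ q∉ p⇒q = below q∈ q∉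
            (≤-trans (lipschitz (P⊆G p∈) (P⊆G q∈) p⇒q) (≤-trans lo (m≤m+n _ 3)))

    Conn-─-geodesic : ∀ {κ} → Nonempty P → Conn T (κ + 4) G → Conn T κ (G ─ P)
    Conn-─-geodesic {κ} P≠∅ conn = large , strong
      where
      large : κ < ∣ G ─ P ∣
      large with argmin lev P P≠∅
      -- Out-neighbours in `P` of its lowest vertex `a` occupy only the levels `lev a` and
      -- `lev a + 1`, so at most two of its `κ + 4` or more out-neighbours lie in `P`.
      ... | a , a∈ , a-min = +-cancelˡ-≤ 2 _ _ (begin
          3 + κ                       ≡⟨ +-comm 3 κ ⟩
          κ + 3                       ≤⟨ +-monoʳ-≤ κ (n≤1+n 3) ⟩
          κ + 4                       ≤⟨ Conn⇒≤outdegree T conn (P⊆G a∈) ⟩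
          ∣ Out T a ∩ G ∣             ≤⟨ p⊆q⇒∣p∣≤∣q∣ split ⟩
          ∣ (Out T a ∩ P) ∪ (G ─ P) ∣ ≤⟨ ∣p∪q∣≤∣p∣+∣q∣ (Out T a ∩ P) (G ─ P) ⟩
          ∣ Out T a ∩ P ∣ + ∣ G ─ P ∣ ≤⟨ +-monoˡ-≤ ∣ G ─ P ∣ two ⟩
          2 + ∣ G ─ P ∣               ∎)
        where
        open ≤-Reasoning
        two : ∣ Out T a ∩ P ∣ ≤ 2
        two = injective-between⇒∣∣≤ lev (Out T a ∩ P) (lev a) 2
          (λ x∈ y∈ → injective (proj₂ (∈Out∩⁻ T x∈)) (proj₂ (∈Out∩⁻ T y∈)))
          (λ x∈ → a-min (proj₂ (∈Out∩⁻ T x∈)))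
          (λ x∈ → ≤-trans (s≤s (lipschitz (P⊆G a∈) (P⊆G (proj₂ (∈Out∩⁻ T x∈))) (proj₁ (∈Out∩⁻ T x∈))))
                          (≤-reflexive (+-comm 2 (lev a))))
        split : Out T a ∩ G ⊆ (Out T a ∩ P) ∪ (G ─ P)
        split {x} x∈ with ∈Out∩⁻ T x∈ | x ∈? P
        ... | a⇒x , x∈G | yes x∈P = p⊆p∪q (G ─ P) (∈Out∩⁺ T a⇒x x∈P)
        ... | a⇒x , x∈G | no x∉P  = q⊆p∪q (Out T a ∩ P) (G ─ P) (x∈p∧x∉q⇒x∈p─q x∈G x∉P)

      strong : ∀ S → ∣ S ∣ < κ → Strong T (G ─ P ─ S)
      strong S S<κ {u} {v} u∈ v∈ = uncut⇒Reach (G ─ P ─ S) u∈ crossing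
        where
        W = G ─ P ─ S
        crossing : ∀ X → X ⊆ W → u ∈ X → v ∉ X → ∃ λ x → ∃ λ y → x ∈ X × (y ∈ W × y ∉ X) × x ⇒ y
        crossing X X⊆ u∈X v∉X
          with Fin.any? (λ x → Fin.any? (λ y → x ∈? X ×-dec ((y ∈? W ×-dec ¬? (y ∈? X)) ×-dec _⇒?_ T x y)))
        ... | yes c = c
        ... | no ¬c = ⊥-elim (Cut.⊥-cut conn S S<κ v∈ X X⊆ u∈X v∉X
          (λ x∈ y∈ y∉ x⇒y → ¬c (_ , _ , x∈ , (y∈ , y∉) , x⇒y)))

-- Distance levels and shortest paths

module _ {n : ℕ} (T : Tournament (Fin n)) where

  open Tournament T

  module Levels (G S : Subset n) where

    entered? : (B : Subset n) → Decidable (λ v → v ∈ G × ∃ λ u → u ∈ B × u ⇒ v)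
    entered? B v = v ∈? G ×-dec Fin.any? (λ u → u ∈? B ×-dec _⇒?_ T u v)

    ball : ℕ → Subset n
    ball zero    = S
    ball (suc i) = ball i ∪ ⟪ entered? (ball i) ⟫

    enter : ∀ {i u v} → v ∈ G → u ∈ ball i → u ⇒ v → v ∈ ball (suc i)
    enter {i} v∈ u∈ u⇒v = q⊆p∪q (ball i) _ (∈⟪⟫⁺ (entered? (ball i)) (v∈ , _ , u∈ , u⇒v))

    Reach⇒ball : ∀ {i u v} → u ∈ ball i → Reach T G u v → ∃ λ j → v ∈ ball j
    Reach⇒ball {i} u∈ ε = i , u∈
    Reach⇒ball {i} u∈ ((_ , e , x∈) ◅ w) = Reach⇒ball {suc i} (enter {i} x∈ u∈ e) w

    -- The value `l` is the first index from `i` to `i + m` whose ball contains `v`; the default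
    -- `suc (i + m)` means that there is none, which is why the membership is conditional.
    search : ∀ v i m → ∃ λ l → i ≤ l × l ≤ suc (i + m) × (l ≤ i + m → v ∈ ball l) ×
                               (∀ {j} → i ≤ j → j < l → v ∉ ball j)
    search v i m with v ∈? ball i
    ... | yes v∈ = i , ≤-refl , m≤n⇒m≤1+n (m≤m+n i m) , (λ _ → v∈) , λ i≤j j<i → contradiction i≤j (<⇒≱ j<i)
    search v i zero | no v∉ = suc i , n≤1+n i , s≤s (m≤m+n i 0)
      , (λ le → contradiction (≤-trans le (≤-reflexive (+-identityʳ i))) (<⇒≱ ≤-refl))
      , λ i≤j j<i v∈ → v∉ (subst (λ j → v ∈ ball j) (≤-antisym (s≤s⁻¹ j<i) i≤j) v∈)
    search v i (suc m) | no v∉ with search v (suc i) m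
    ... | l , i<l , l≤ , hit , miss = l , <⇒≤ i<l , subst (λ k → l ≤ suc k) (sym (+-suc i m)) l≤
      , (λ le → hit (subst (l ≤_) (+-suc i m) le)) , miss′
      where
      miss′ : ∀ {j} → i ≤ j → j < l → v ∉ ball j
      miss′ {j} i≤j j<l v∈ with m≤n⇒m<n∨m≡n i≤j
      ... | inj₁ i<j  = miss i<j j<l v∈
      ... | inj₂ refl = v∉ v∈

  -- lev is the distance from S in G, cut off at bound + 1.
  record Distance (G S : Subset n) : Set where
    field
      lev       : Fin n → ℕ
      bound     : ℕ
      lipschitz : ∀ {u v} → u ∈ G → v ∈ G → u ⇒ v → lev v ≤ suc (lev u)
      lev≡0⁺    : ∀ {v} → v ∈ S → lev v ≡ 0
      lev≡0⁻    : ∀ {v} → lev v ≡ 0 → v ∈ S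
      previous  : ∀ {v l} → lev v ≡ suc l → lev v ≤ bound → v ∈ G × ∃ λ u → lev u ≡ l × u ⇒ v

  distance : ∀ {G S s t} → s ∈ S → Reach T G s t →
             ∃ λ (D : Distance G S) → Distance.lev D t ≤ Distance.bound D
  -- The cut-off `N` is the index of some ball containing `t`, so the level of `t` is its true
  -- distance.
  distance {G} {S} {s} {t} s∈ w with Levels.Reach⇒ball G S {0} s∈ w
  ... | N , t∈ = record
      { lev       = lev
      ; bound     = N
      ; lipschitz = λ _ → lipschitz
      ; lev≡0⁺    = λ v∈ → n≤0⇒n≡0 (∈ball⇒lev≤ v∈)
      ; lev≡0⁻    = λ {v} eq → subst (λ l → v ∈ ball l) eq (∈ball-lev (≤-trans (≤-reflexive eq) z≤n))
      ; previous  = previous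
      } , ∈ball⇒lev≤ t∈
    where
    open Levels G S

    lev : Fin n → ℕ
    lev v = proj₁ (search v 0 N)

    lev≤1+N : ∀ v → lev v ≤ suc N
    lev≤1+N v = proj₁ (proj₂ (proj₂ (search v 0 N)))

    ∈ball-lev : ∀ {v} → lev v ≤ N → v ∈ ball (lev v)
    ∈ball-lev {v} = proj₁ (proj₂ (proj₂ (proj₂ (search v 0 N))))

    ∈ball⇒lev≤ : ∀ {v j} → v ∈ ball j → lev v ≤ j
    ∈ball⇒lev≤ {v} v∈ = ≮⇒≥ λ j< → proj₂ (proj₂ (proj₂ (proj₂ (search v 0 N)))) z≤n j< v∈

    lipschitz : ∀ {u v} → v ∈ G → u ⇒ v → lev v ≤ suc (lev u)
    lipschitz {u} {v} v∈ u⇒v with lev u ≤? N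
    ... | yes le = ∈ball⇒lev≤ {v} (enter {lev u} {u} v∈ (∈ball-lev {u} le) u⇒v)
    -- Beyond the cut-off `lev u` is already the largest possible level.
    ... | no ¬le = ≤-trans (lev≤1+N v) (≤-trans (≰⇒> ¬le) (n≤1+n (lev u)))

    previous : ∀ {v l} → lev v ≡ suc l → lev v ≤ N → v ∈ G × ∃ λ u → lev u ≡ l × u ⇒ v
    -- Since `v` enters the balls only at index `suc l`, it has an in-neighbour in `ball l`; by the
    -- Lipschitz bound that vertex has level exactly `l`.
    previous {v} {l} eq le with x∈p∪q⁻ (ball l) _ (subst (λ l → v ∈ ball l) eq (∈ball-lev {v} le))
    ... | inj₁ v∈ball = contradiction (∈ball⇒lev≤ {v} v∈ball) (<⇒≱ (≤-reflexive (sym eq)))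
    ... | inj₂ v∈new with ∈⟪⟫⁻ (entered? (ball l)) v∈new
    ...   | v∈G , u , u∈ , u⇒v = v∈G , u
      , ≤-antisym (∈ball⇒lev≤ {u} u∈) (s≤s⁻¹ (≤-trans (≤-reflexive (sym eq)) (lipschitz {u} v∈G u⇒v))) , u⇒v

  module _ {G S : Subset n} (D : Distance G S) where

    open Distance D

    -- A shortest walk from `S` to `v` as a vertex set: by `injective`, `lev≤` and `at-level`, `lev`
    -- numbers its vertices from 0 to `lev v`.
    record Geodesic (v : Fin n) : Set where
      field
        P         : Subset n
        P⊆G       : P ⊆ G
        injective : ∀ {p q} → p ∈ P → q ∈ P → lev p ≡ lev q → p ≡ q
        end∈      : v ∈ P
        lev≤      : ∀ {p} → p ∈ P → lev p ≤ lev v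
        start     : Fin n
        start∈P   : start ∈ P
        start∈S   : start ∈ S
        walk      : Reach T P start v
        at-level  : ∀ {i} → i ≤ lev v → ∃ λ p → p ∈ P × lev p ≡ i

    geodesic : S ⊆ G → ∀ l {v} → lev v ≡ l → lev v ≤ bound → Geodesic v
    geodesic S⊆G zero {v} lev≡ lev≤N = record
      { P         = ⁅ v ⁆
      ; P⊆G       = λ p∈ → subst (_∈ G) (sym (x∈⁅y⁆⇒x≡y v p∈)) (S⊆G v∈S)
      ; injective = λ p∈ q∈ _ → trans (x∈⁅y⁆⇒x≡y v p∈) (sym (x∈⁅y⁆⇒x≡y v q∈))
      ; end∈      = x∈⁅x⁆ v
      ; lev≤      = λ p∈ → ≤-reflexive (cong lev (x∈⁅y⁆⇒x≡y v p∈))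
      ; start     = v
      ; start∈P   = x∈⁅x⁆ v
      ; start∈S   = v∈S
      ; walk      = ε
      ; at-level  = λ i≤ → v , x∈⁅x⁆ v , trans lev≡ (sym (n≤0⇒n≡0 (subst (_ ≤_) lev≡ i≤)))
      }
      where
      v∈S : v ∈ S
      v∈S = lev≡0⁻ lev≡
    geodesic S⊆G (suc l) {v} lev≡ lev≤N
      with previous lev≡ lev≤N
    ... | v∈G , u , levu≡ , u⇒v = record
      { P         = ⁅ v ⁆ ∪ Γ.P
      ; P⊆G       = λ p∈ → [ (λ p∈v → subst (_∈ G) (sym (x∈⁅y⁆⇒x≡y v p∈v)) v∈G) , Γ.P⊆G ]′ (P⁻ p∈)
      ; injective = λ p∈ q∈ → injective (P⁻ p∈) (P⁻ q∈)
      ; end∈      = v∈P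
      ; lev≤      = λ p∈ → [ (λ p∈v → ≤-reflexive (cong lev (x∈⁅y⁆⇒x≡y v p∈v))) , <⇒≤ ∘ below ]′ (P⁻ p∈)
      ; start     = Γ.start
      ; start∈P   = later Γ.start∈P
      ; start∈S   = Γ.start∈S
      ; walk      = Reach-mono T later Γ.walk ◅◅ (later Γ.end∈ , u⇒v , v∈P) ◅ ε
      ; at-level  = at-level
      }
      where
      module Γ = Geodesic (geodesic S⊆G l {u} levu≡
        (subst (_≤ bound) (sym levu≡) (≤-trans (n≤1+n l) (subst (_≤ bound) lev≡ lev≤N))))
      P⁻ : ∀ {p} → p ∈ ⁅ v ⁆ ∪ Γ.P → p ∈ ⁅ v ⁆ ⊎ p ∈ Γ.P
      P⁻ = x∈p∪q⁻ ⁅ v ⁆ Γ.P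
      later : Γ.P ⊆ ⁅ v ⁆ ∪ Γ.P
      later = q⊆p∪q ⁅ v ⁆ Γ.P
      v∈P : v ∈ ⁅ v ⁆ ∪ Γ.P
      v∈P = p⊆p∪q Γ.P (x∈⁅x⁆ v)
      below : ∀ {p} → p ∈ Γ.P → lev p < lev v
      below p∈ = ≤-trans (s≤s (Γ.lev≤ p∈)) (≤-reflexive (trans (cong suc levu≡) (sym lev≡)))
      injective : ∀ {p q} → p ∈ ⁅ v ⁆ ⊎ p ∈ Γ.P → q ∈ ⁅ v ⁆ ⊎ q ∈ Γ.P → lev p ≡ lev q → p ≡ q
      injective (inj₁ p∈) (inj₁ q∈) _ = trans (x∈⁅y⁆⇒x≡y v p∈) (sym (x∈⁅y⁆⇒x≡y v q∈))
      injective (inj₁ p∈) (inj₂ q∈) eq =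
        contradiction (trans (sym eq) (cong lev (x∈⁅y⁆⇒x≡y v p∈))) (<⇒≢ (below q∈))
      injective (inj₂ p∈) (inj₁ q∈) eq =
        contradiction (trans eq (cong lev (x∈⁅y⁆⇒x≡y v q∈))) (<⇒≢ (below p∈))
      injective (inj₂ p∈) (inj₂ q∈) eq = Γ.injective p∈ q∈ eq
      at-level : ∀ {i} → i ≤ lev v → ∃ λ p → p ∈ ⁅ v ⁆ ∪ Γ.P × lev p ≡ i
      at-level {i} i≤ with m≤n⇒m<n∨m≡n i≤
      ... | inj₂ refl = v , v∈P , refl
      ... | inj₁ i<   with Γ.at-level (subst (i ≤_) (sym levu≡) (s≤s⁻¹ (subst (i <_) lev≡ i<)))
      ...   | p , p∈ , eq = p , later p∈ , eq

  -- front and rear are the first and the last k + 2 vertices of a shortest path,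
  -- along which no arc of T advances by more than one step.
  record Link (k : ℕ) (G S S′ : Subset n) : Set where
    field
      path        : Subset n
      start end   : Fin n
      path⊆       : path ⊆ G
      start∈      : start ∈ path
      start∈S     : start ∈ S
      end∈        : end ∈ path
      end∈S′      : end ∈ S′
      only-start  : ∀ {x} → x ∈ path → x ∈ S → x ≡ start
      only-end    : ∀ {x} → x ∈ path → x ∈ S′ → x ≡ end
      walk        : Reach T path start end
      front rear  : Subset n
      ∣front∣≤    : ∣ front ∣ ≤ 2 + k
      ∣rear∣≤     : ∣ rear ∣ ≤ 2 + k
      front⊆      : front ⊆ path
      rear⊆       : rear ⊆ path
      to-front    : ∀ {x} → x ∈ path → x ∉ front → AtLeast k (λ y → y ∈ front × x ⇒ y)
      from-rear   : ∀ {x} → x ∈ path → x ∉ rear → AtLeast k (λ y → y ∈ rear × y ⇒ x)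

  -- The path is a geodesic to a vertex `t` of `S′` nearest to `S`. It meets `S` only at level 0,
  -- and it meets `S′` only in `t` because all its other vertices are nearer to `S`.
  link : ∀ k {κ G S S′} → Conn T (κ + 4) G → S ⊆ G → S′ ⊆ G → Nonempty S → Nonempty S′ →
         ∃ λ (L : Link k G S S′) → Conn T κ (G ─ Link.path L)
  link k {κ} {G} {S} {S′} conn S⊆ S′⊆ (s , s∈) (s′ , s′∈)
    with distance s∈
           (subst (λ U → Reach T U s s′) (p─⊥≡p G)
             (proj₂ conn Subset.⊥ (≤-<-trans (≤-reflexive (∣⊥∣≡0 n)) (≤-trans (s≤s z≤n) (m≤n+m 4 κ)))
               (subst (s ∈_) (sym (p─⊥≡p G)) (S⊆ s∈)) (subst (s′ ∈_) (sym (p─⊥≡p G)) (S′⊆ s′∈))))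
  ... | D , s′-near with argmin (Distance.lev D) S′ (s′ , s′∈)
  ... | t , t∈ , t-min = record
      { path       = P
      ; start      = start
      ; end        = t
      ; path⊆      = P⊆G
      ; start∈     = start∈P
      ; start∈S    = start∈S
      ; end∈       = end∈
      ; end∈S′     = t∈
      ; only-start = λ x∈ x∈S → injective x∈ start∈P
          (trans (lev≡0⁺ x∈S) (sym (lev≡0⁺ start∈S)))
      ; only-end   = λ x∈ x∈S′ → injective x∈ end∈ (≤-antisym (lev≤ x∈) (t-min x∈S′))
      ; walk       = walk
      ; front      = ⟪ front? ⟫
      ; rear       = ⟪ rear? ⟫
      ; ∣front∣≤   = injective-below⇒∣∣≤ lev ⟪ front? ⟫ (2 + k)
          (λ x∈ y∈ → injective (front⊆ x∈) (front⊆ y∈)) (s≤s ∘ proj₂ ∘ ∈⟪⟫⁻ front?)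
      ; ∣rear∣≤    = injective-between⇒∣∣≤ T lev ⟪ rear? ⟫ (lev t ∸ suc k) (2 + k)
          (λ x∈ y∈ → injective (rear⊆ x∈) (rear⊆ y∈))
          (λ x∈ → m≤n+o⇒m∸n≤o (lev t) (suc k)
             (≤-trans (proj₂ (∈⟪⟫⁻ rear? x∈)) (≤-reflexive (+-comm _ (suc k)))))
          (λ x∈ → ≤-trans (s≤s (≤-trans (lev≤ (rear⊆ x∈)) (m≤n+m∸n (lev t) (suc k))))
             (≤-reflexive (+-comm (2 + k) (lev t ∸ suc k))))
      ; front⊆     = front⊆
      ; rear⊆      = rear⊆
      ; to-front   = to-front
      ; from-rear  = from-rear
      } , Conn-─-geodesic T lev P⊆G lipschitz injective (t , end∈) conn
    where
    open Distance D
    open Geodesic (geodesic D S⊆ (lev t) refl (≤-trans (t-min s′∈) s′-near))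

    front? : Decidable (λ p → p ∈ P × lev p ≤ suc k)
    front? p = p ∈? P ×-dec lev p ≤? suc k

    rear? : Decidable (λ p → p ∈ P × lev t ≤ lev p + suc k)
    rear? p = p ∈? P ×-dec lev t ≤? lev p + suc k

    front⊆ : ⟪ front? ⟫ ⊆ P
    front⊆ = proj₁ ∘ ∈⟪⟫⁻ front?

    rear⊆ : ⟪ rear? ⟫ ⊆ P
    rear⊆ = proj₁ ∘ ∈⟪⟫⁻ rear?

    -- An arc from `q` to `p` would gain more than one level, so the arc between them points
    -- backwards.
    descend : ∀ {p q} → p ∈ P → q ∈ P → suc (lev q) < lev p → p ⇒ q
    descend p∈ q∈ q<p = reversed T (λ { refl → <⇒≱ q<p (n≤1+n _) })
      (λ q⇒p → <⇒≱ q<p (lipschitz (P⊆G q∈) (P⊆G p∈) q⇒p))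

    i≤k : ∀ (i : Fin k) → toℕ i ≤ k
    i≤k i = <⇒≤ (Fin.toℕ<n i)

    pick : (f : Fin k → ℕ) → (∀ {i j} → f i ≡ f j → i ≡ j) → (∀ i → f i ≤ lev t) →
           AtLeast k (λ y → y ∈ P × ∃ λ i → lev y ≡ f i)
    pick f f-inj f≤ = tabulateₗ y
      , Unique.tabulate⁺ (λ {i} {j} eq → f-inj (trans (sym (lev-y i)) (trans (cong lev eq) (lev-y j))))
      , length-tabulate y
      , All.tabulate⁺ (λ i → proj₁ (proj₂ (at-level (f≤ i))) , i , lev-y i)
      where
      y : Fin k → Fin n
      y i = proj₁ (at-level (f≤ i))
      lev-y : ∀ i → lev (y i) ≡ f i
      lev-y i = proj₂ (proj₂ (at-level (f≤ i)))

    -- The vertices at levels 0 to `k - 1` serve: outside the front the level of `x` is at least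
    -- `k + 2`, so `descend` applies to each of them.
    to-front : ∀ {x} → x ∈ P → x ∉ ⟪ front? ⟫ → AtLeast k (λ y → y ∈ ⟪ front? ⟫ × x ⇒ y)
    to-front {x} x∈ x∉ = AtLeast-map
        (λ { (y∈ , i , eq) → ∈⟪⟫⁺ front? (y∈ , subst (_≤ suc k) (sym eq) (≤-trans (i≤k i) (n≤1+n k)))
             , descend x∈ y∈ (subst (λ l → suc l < lev x) (sym eq) (≤-trans (s≤s (s≤s (i≤k i))) deep)) })
        (pick toℕ Fin.toℕ-injective (λ i → ≤-trans (i≤k i) (≤-trans (m≤n+m k 2) (≤-trans deep (lev≤ x∈)))))
      where
      deep : 2 + k ≤ lev x
      deep = ≰⇒> λ le → x∉ (∈⟪⟫⁺ front? (x∈ , le))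

    -- Symmetrically, the `k` highest levels, `lev t ∸ toℕ i`, all exceed the level of `x` by more
    -- than one.
    from-rear : ∀ {x} → x ∈ P → x ∉ ⟪ rear? ⟫ → AtLeast k (λ y → y ∈ ⟪ rear? ⟫ × y ⇒ x)
    from-rear {x} x∈ x∉ = AtLeast-map
        (λ { {y} (y∈ , i , eq) → ∈⟪⟫⁺ rear? (y∈ , (begin
                 lev t                       ≡⟨ sym (m∸n+n≡m (toℕ≤ i)) ⟩
                 (lev t ∸ toℕ i) + toℕ i     ≡⟨ cong (_+ toℕ i) (sym eq) ⟩
                 lev y + toℕ i               ≤⟨ +-monoʳ-≤ (lev y) (≤-trans (<⇒≤ (Fin.toℕ<n i)) (n≤1+n k)) ⟩
                 lev y + suc k               ∎))
             , descend y∈ x∈ (+-cancelʳ-≤ (toℕ i) _ _ (begin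
                 2 + lev x + toℕ i           ≡⟨ cong suc (sym (+-suc (lev x) (toℕ i))) ⟩
                 suc (lev x + suc (toℕ i))   ≤⟨ s≤s (+-monoʳ-≤ (lev x) (≤-trans (Fin.toℕ<n i) (n≤1+n k))) ⟩
                 suc (lev x + suc k)         ≤⟨ shallow ⟩
                 lev t                       ≡⟨ sym (m∸n+n≡m (toℕ≤ i)) ⟩
                 (lev t ∸ toℕ i) + toℕ i     ≡⟨ cong (_+ toℕ i) (sym eq) ⟩
                 lev y + toℕ i               ∎)) })
        (pick (λ i → lev t ∸ toℕ i) (λ {i} {j} eq → Fin.toℕ-injective (∸-cancelˡ-≡ (toℕ≤ i) (toℕ≤ j) eq))
              (λ i → m∸n≤m (lev t) (toℕ i)))
      where
      open ≤-Reasoning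
      shallow : lev x + suc k < lev t
      shallow = ≰⇒> λ le → x∉ (∈⟪⟫⁺ rear? (x∈ , le))
      toℕ≤ : ∀ (i : Fin k) → toℕ i ≤ lev t
      toℕ≤ i = ≤-trans (≤-trans (≤-trans (i≤k i) (n≤1+n k)) (≤-trans (m≤n+m (suc k) (lev x)) (n≤1+n _)))
                       shallow

  -- The path avoids `P`, so it meets `S` and `S′` exactly where it meets `S ─ P` and `S′ ─ P`.
  Link-enlarge : ∀ {k G S S′} P → Link k (G ─ P) (S ─ P) (S′ ─ P) → Link k G S S′
  Link-enlarge {k} {G} {S} {S′} P L = record
    { Link L
    ; path⊆      = p─q⊆p G P ∘ path⊆
    ; start∈S    = p─q⊆p S P start∈S
    ; end∈S′     = p─q⊆p S′ P end∈S′
    ; only-start = λ x∈ x∈S → only-start x∈ (x∈p∧x∉q⇒x∈p─q x∈S (proj₂ (x∈p─q⁻ G P (path⊆ x∈))))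
    ; only-end   = λ x∈ x∈S′ → only-end x∈ (x∈p∧x∉q⇒x∈p─q x∈S′ (proj₂ (x∈p─q⁻ G P (path⊆ x∈))))
    }
    where open Link L

  -- Disjoint paths

  record Linkage (k m κ : ℕ) (G S S′ : Subset n) : Set where
    field
      links    : Fin m → Link k G S S′
      disjoint : ∀ {i j x} → x ∈ Link.path (links i) → x ∈ Link.path (links j) → i ≡ j
      rest     : Subset n
      rest⊆    : rest ⊆ G
      covered  : ∀ {x} → x ∈ G → x ∉ rest → ∃ λ i → x ∈ Link.path (links i)
      avoids   : ∀ {x i} → x ∈ rest → x ∉ Link.path (links i)
      conn     : Conn T κ rest

  linkage-∷ : ∀ {k m κ G S S′} (L : Link k G S S′) → (let P = Link.path L) →
              Linkage k m κ (G ─ P) (S ─ P) (S′ ─ P) → Linkage k (suc m) κ G S S′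
  linkage-∷ {k} {m} {κ} {G} {S} {S′} L Ls = record
    { links    = links
    ; disjoint = λ {i} {j} → disjoint {i} {j}
    ; rest     = Ls.rest
    ; rest⊆    = p─q⊆p G L.path ∘ Ls.rest⊆
    ; covered  = covered
    ; avoids   = λ {x} {i} → avoids {x} {i}
    ; conn     = Ls.conn
    }
    where
    module L = Link L
    module Ls = Linkage Ls

    links : Fin (suc m) → Link k G S S′
    links zero    = L
    links (suc i) = Link-enlarge L.path (Ls.links i)

    later∉ : ∀ {i x} → x ∈ Link.path (Ls.links i) → x ∉ L.path
    later∉ {i} x∈ = proj₂ (x∈p─q⁻ G L.path (Link.path⊆ (Ls.links i) x∈))

    disjoint : ∀ {i j x} → x ∈ Link.path (links i) → x ∈ Link.path (links j) → i ≡ j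
    disjoint {zero}  {zero}  _ _   = refl
    disjoint {zero}  {suc j} x∈ x∈′ = contradiction x∈ (later∉ {j} x∈′)
    disjoint {suc i} {zero}  x∈ x∈′ = contradiction x∈′ (later∉ {i} x∈)
    disjoint {suc i} {suc j} x∈ x∈′ = cong suc (Ls.disjoint x∈ x∈′)

    covered : ∀ {x} → x ∈ G → x ∉ Ls.rest → ∃ λ i → x ∈ Link.path (links i)
    covered {x} x∈ x∉ with x ∈? L.path
    ... | yes x∈P = zero , x∈P
    ... | no x∉P with Ls.covered (x∈p∧x∉q⇒x∈p─q x∈ x∉P) x∉
    ...   | i , x∈P = suc i , x∈P

    avoids : ∀ {x i} → x ∈ Ls.rest → x ∉ Link.path (links i)
    avoids {i = zero}  x∈ = proj₂ (x∈p─q⁻ G L.path (Ls.rest⊆ x∈))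
    avoids {i = suc i} x∈ = Ls.avoids {i = i} x∈

  -- Greedy choice: each link lowers the connectivity by at most 4 and uses one vertex of `S` and
  -- one of `S′`, so enough of both remain for the other links.
  linkage : ∀ k m {κ G S S′} → Conn T (κ + m * 4) G → S ⊆ G → S′ ⊆ G →
            m ≤ ∣ S ∣ → m ≤ ∣ S′ ∣ → Linkage k m κ G S S′
  linkage k zero {κ} {G} conn S⊆ S′⊆ _ _ = record
    { links    = λ ()
    ; disjoint = λ { {()} }
    ; rest     = G
    ; rest⊆    = id
    ; covered  = λ x∈ x∉ → contradiction x∈ x∉
    ; avoids   = λ { {i = ()} }
    ; conn     = subst (λ κ → Conn T κ G) (+-identityʳ κ) conn
    }
  linkage k (suc m) {κ} {G} {S} {S′} conn S⊆ S′⊆ m<S m<S′ =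
    extend (link k (subst (λ κ → Conn T κ G) eq conn) S⊆ S′⊆
      (0<∣p∣⇒Nonempty S (≤-trans (s≤s z≤n) m<S)) (0<∣p∣⇒Nonempty S′ (≤-trans (s≤s z≤n) m<S′)))
    where
    eq : κ + suc m * 4 ≡ κ + m * 4 + 4
    eq = trans (cong (κ +_) (+-comm 4 (m * 4))) (sym (+-assoc κ (m * 4) 4))

    shrink : ∀ {S P} → S ⊆ G → S ─ P ⊆ G ─ P
    shrink {S} {P} S⊆ x∈ with x∈p─q⁻ S P x∈
    ... | x∈S , x∉ = x∈p∧x∉q⇒x∈p─q (S⊆ x∈S) x∉

    remove : (P S : Subset n) (s : Fin n) → (∀ {x} → x ∈ P → x ∈ S → x ≡ s) →
             suc m ≤ ∣ S ∣ → m ≤ ∣ S ─ P ∣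
    remove P S s only m<S = s≤s⁻¹ (≤-trans m<S (≤-trans (∣p∣≤1+∣p-x∣ S s) (s≤s (p⊆q⇒∣p∣≤∣q∣ keep))))
      where
      keep : S - s ⊆ S ─ P
      keep x∈ with x∈p─q⁻ S ⁅ s ⁆ x∈
      ... | x∈S , x∉ = x∈p∧x∉q⇒x∈p─q x∈S (λ x∈P → x∉ (subst (_∈ ⁅ s ⁆) (sym (only x∈P x∈S)) (x∈⁅x⁆ s)))

    extend : (∃ λ (L : Link k G S S′) → Conn T (κ + m * 4) (G ─ Link.path L)) →
             Linkage k (suc m) κ G S S′
    extend (L , conn′) = linkage-∷ L (linkage k m conn′ (shrink S⊆) (shrink S′⊆)
      (remove path S start only-start m<S) (remove path S′ end only-end m<S′))
      where open Link L

-- Splitting off one class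

module _ {n : ℕ} where

  ∣q∩r∣≤ : (q r e : Subset n) → ∣ q ∩ r ∣ ≤ ∣ q ∩ (r ─ e) ∣ + ∣ e ∣
  ∣q∩r∣≤ q r e = ≤-trans (p⊆q⇒∣p∣≤∣q∣ split) (∣p∪q∣≤∣p∣+∣q∣ (q ∩ (r ─ e)) e)
    where
    split : q ∩ r ⊆ (q ∩ (r ─ e)) ∪ e
    split {x} x∈ with x∈p∩q⁻ q r x∈ | x ∈? e
    ... | x∈q , x∈r | yes x∈e = q⊆p∪q (q ∩ (r ─ e)) e x∈e
    ... | x∈q , x∈r | no x∉e  = p⊆p∪q e (x∈p∩q⁺ (x∈q , x∈p∧x∉q⇒x∈p─q x∈r x∉e))

  length-concatMap≤ : ∀ {A : Set} (f : A → List (Fin n)) {b} → (∀ x → length (f x) ≤ b) →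
                      ∀ xs → length (concatMap f xs) ≤ length xs * b
  length-concatMap≤ f f≤ []       = z≤n
  length-concatMap≤ f {b} f≤ (x ∷ xs) = subst (_≤ b + length xs * b) (sym (length-++ (f x)))
    (+-mono-≤ (f≤ x) (length-concatMap≤ f f≤ xs))

  -- If every `P i` contained the image of an element of `D`, these elements would be distinct
  -- because the `P i` are disjoint, giving `m` elements of `D`. With `h` the anchor map, a path
  -- counts as hit also when one of its two fans loses a vertex.
  unhit-preimage : ∀ {m} (h : Fin n → Fin n) (P : Fin m → Subset n) (D : Subset n) → ∣ D ∣ < m →
    (∀ {i j x} → x ∈ P i → x ∈ P j → i ≡ j) → ∃ λ i → ∀ {d} → h d ∈ P i → d ∉ D
  unhit-preimage {m} h P D D<m disjoint
    with Fin.any? (λ i → Fin.all? (λ d → ¬? (d ∈? D ×-dec h d ∈? P i)))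
  ... | yes (i , free) = i , λ {d} hd∈ d∈ → free d (d∈ , hd∈)
  ... | no ¬free = contradiction
      (subst (_≤ ∣ D ∣) (length-tabulate {n = m} d) (unique-length≤
        (Unique.tabulate⁺ (λ {i} {j} eq → disjoint (proj₂ (hit i))
          (subst (λ e → h e ∈ P j) (sym eq) (proj₂ (hit j)))))
        (All.tabulate⁺ (λ i → proj₁ (hit i))))) (<⇒≱ D<m)
    where
    hitter : ∀ i → ∃ λ d → d ∈ D × h d ∈ P i
    hitter i with Fin.any? (λ d → d ∈? D ×-dec h d ∈? P i)
    ... | yes found = found
    ... | no none   = contradiction (i , λ d hit → none (d , hit)) ¬free
    d : Fin m → Fin n
    d i = proj₁ (hitter i)
    hit : ∀ i → d i ∈ D × h (d i) ∈ P i
    hit i = proj₂ (hitter i)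

-- Collecting neighbours outside the exceptional sets

module _ {n : ℕ} (T : Tournament (Fin n)) where

  open Tournament T

  collect : ∀ k Z X → (∀ {x} → x List.∈ X → k ≤ ∣ Out T x ∩ Z ∣) →
    ∃ λ Q → length Q ≤ length X * k × (∀ {q} → q List.∈ Q → q ∈ Z) ×
            (∀ {x} → x List.∈ X → AtLeast k (λ q → q List.∈ Q × x ⇒ q))
  collect k Z []      _ = [] , z≤n , (λ ()) , λ ()
  collect k Z (x ∷ X) h with choose k (Out T x ∩ Z) (h (here refl)) | collect k Z X (h ∘ there)
  ... | ys , ys! , refl , ys∈ | Q , Q≤ , Q⊆ , ih = ys ++ Q
      , subst (_≤ length ys + length X * length ys) (sym (length-++ ys)) (+-monoʳ-≤ (length ys) Q≤)
      , [ proj₂ ∘ ∈Out∩⁻ T ∘ All.lookup ys∈ , Q⊆ ]′ ∘ ∈-++⁻ ys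
      , λ { (here refl) → ys , ys! , refl
              , All.tabulate (λ y∈ → ∈-++⁺ˡ y∈ , proj₁ (∈Out∩⁻ T (All.lookup ys∈ y∈)))
          ; (there x∈) → AtLeast-map (λ (q∈ , e) → ∈-++⁺ʳ ys q∈ , e) (ih x∈) }

-- After fewer than `k` deletions every remaining vertex of `Y ++ Q` lies outside `E` or has an
-- out-neighbour there, and dually for `E′`. The size bound allows `k` neighbours in one direction
-- for each vertex of `Y`, then `k` in the other direction for everything collected so far.
record Nursery {n} (T : Tournament (Fin n)) (k : ℕ) (N E E′ : Subset n) (Y : List (Fin n)) : Set where
  open Tournament T
  field
    Q    : List (Fin n)
    size : length Q ≤ length Y * k + (length Y + length Y * k) * k
    Q⊆   : ∀ {q} → q List.∈ Q → q ∈ N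
    outs : ∀ {v} → v List.∈ Y ++ Q → v ∉ E ⊎ AtLeast k (λ q → q List.∈ Q × q ∉ E × v ⇒ q)
    ins  : ∀ {v} → v List.∈ Y ++ Q → v ∉ E′ ⊎ AtLeast k (λ q → q List.∈ Q × q ∉ E′ × q ⇒ v)

-- The out-neighbours may lie in E′, but the in-neighbours, chosen afterwards
-- against the larger degree bound, avoid both sets, so the process stops.
nursery-≤ : ∀ {n} (T : Tournament (Fin n)) k N E E′ Y → ∣ E ∣ ≤ ∣ E′ ∣ → (∀ {y} → y List.∈ Y → y ∈ N) →
  (∀ {v} → v ∈ N → k + 2 * ∣ E ∣ ≤ ∣ Out T v ∩ N ∣) →
  (∀ {v} → v ∈ N → k + 2 * ∣ E′ ∣ ≤ ∣ Out (op T) v ∩ N ∣) → Nursery T k N E E′ Y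
nursery-≤ {n} T k N E E′ Y E≤E′ Y⊆ out-large in-large = build
    (collect T k (N ─ E) Y (λ y∈ → +-cancelʳ-≤ ∣ E ∣ k _ (≤-trans
      (+-monoʳ-≤ k (m≤n*m ∣ E ∣ 2)) (≤-trans (out-large (Y⊆ y∈)) (∣q∩r∣≤ (Out T _) N E)))))
  where
  open Tournament T
  build : (∃ λ Q → length Q ≤ length Y * k × (∀ {q} → q List.∈ Q → q ∈ N ─ E) ×
            (∀ {x} → x List.∈ Y → AtLeast k (λ q → q List.∈ Q × x ⇒ q))) → Nursery T k N E E′ Y
  build (Q₁ , Q₁≤ , Q₁⊆ , Q₁-out) = finish (collect (op T) k (N ─ (E ∪ E′)) (Y ++ Q₁)
      (λ v∈ → +-cancelʳ-≤ ∣ E ∪ E′ ∣ k _ (≤-trans (+-monoʳ-≤ k E∪E′≤)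
        (≤-trans (in-large ([ Y⊆ , p─q⊆p N E ∘ Q₁⊆ ]′ (∈-++⁻ Y v∈))) (∣q∩r∣≤ (Out (op T) _) N (E ∪ E′))))))
    where
    E∪E′≤ : ∣ E ∪ E′ ∣ ≤ 2 * ∣ E′ ∣
    E∪E′≤ = ≤-trans (∣p∪q∣≤∣p∣+∣q∣ E E′) (≤-trans (+-monoˡ-≤ ∣ E′ ∣ E≤E′)
      (≤-reflexive (cong (∣ E′ ∣ +_) (sym (+-identityʳ ∣ E′ ∣)))))
    finish : (∃ λ Q → length Q ≤ length (Y ++ Q₁) * k × (∀ {q} → q List.∈ Q → q ∈ N ─ (E ∪ E′)) ×
            (∀ {x} → x List.∈ Y ++ Q₁ → AtLeast k (λ q → q List.∈ Q × q ⇒ x))) → Nursery T k N E E′ Y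
    finish (Q₂ , Q₂≤ , Q₂⊆ , Q₂-in) = record
      { Q    = Q₁ ++ Q₂
      ; size = subst (_≤ length Y * k + (length Y + length Y * k) * k) (sym (length-++ Q₁))
          (+-mono-≤ Q₁≤ (≤-trans Q₂≤ (*-monoˡ-≤ k (subst (_≤ length Y + length Y * k) (sym (length-++ Y))
            (+-monoʳ-≤ (length Y) Q₁≤)))))
      ; Q⊆   = [ p─q⊆p N E ∘ Q₁⊆ , p─q⊆p N (E ∪ E′) ∘ Q₂⊆ ]′ ∘ ∈-++⁻ Q₁
      ; outs = outs
      ; ins  = ins
      }
      where
      Q₁∉ : ∀ {q} → q List.∈ Q₁ → q ∉ E
      Q₁∉ q∈ = proj₂ (x∈p─q⁻ N E (Q₁⊆ q∈))
      Q₂∉ : ∀ {q} → q List.∈ Q₂ → q ∉ E ∪ E′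
      Q₂∉ q∈ = proj₂ (x∈p─q⁻ N (E ∪ E′) (Q₂⊆ q∈))
      outs : ∀ {v} → v List.∈ Y ++ Q₁ ++ Q₂ →
             v ∉ E ⊎ AtLeast k (λ q → q List.∈ Q₁ ++ Q₂ × q ∉ E × v ⇒ q)
      outs v∈ with ∈-++⁻ Y v∈
      ... | inj₁ v∈Y = inj₂ (AtLeast-map (λ (q∈ , e) → ∈-++⁺ˡ q∈ , Q₁∉ q∈ , e) (Q₁-out v∈Y))
      ... | inj₂ v∈Q = inj₁ ([ Q₁∉ , (λ q∈ → Q₂∉ q∈ ∘ p⊆p∪q E′) ]′ (∈-++⁻ Q₁ v∈Q))
      ins : ∀ {v} → v List.∈ Y ++ Q₁ ++ Q₂ →
            v ∉ E′ ⊎ AtLeast k (λ q → q List.∈ Q₁ ++ Q₂ × q ∉ E′ × q ⇒ v)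
      ins {v} v∈ with ∈-++⁻ Y v∈
      ... | inj₁ v∈Y = inj₂ (AtLeast-map (λ (q∈ , e) → ∈-++⁺ʳ Q₁ q∈ , Q₂∉ q∈ ∘ q⊆p∪q E E′ , e)
                              (Q₂-in (∈-++⁺ˡ v∈Y)))
      ... | inj₂ v∈Q with ∈-++⁻ Q₁ v∈Q
      ...   | inj₁ v∈Q₁ = inj₂ (AtLeast-map (λ (q∈ , e) → ∈-++⁺ʳ Q₁ q∈ , Q₂∉ q∈ ∘ q⊆p∪q E E′ , e)
                                 (Q₂-in (∈-++⁺ʳ Y v∈Q₁)))
      ...   | inj₂ v∈Q₂ = inj₁ (Q₂∉ v∈Q₂ ∘ q⊆p∪q E E′)

-- Reversing all arcs exchanges `E` and `E′`, so the smaller one may be treated first.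
nursery : ∀ {n} (T : Tournament (Fin n)) k N E E′ Y → (∀ {y} → y List.∈ Y → y ∈ N) →
  (∀ {v} → v ∈ N → k + 2 * ∣ E ∣ ≤ ∣ Out T v ∩ N ∣) →
  (∀ {v} → v ∈ N → k + 2 * ∣ E′ ∣ ≤ ∣ Out (op T) v ∩ N ∣) → Nursery T k N E E′ Y
nursery T k N E E′ Y Y⊆ out-large in-large with ≤-total ∣ E ∣ ∣ E′ ∣
... | inj₁ le = nursery-≤ T k N E E′ Y le Y⊆ out-large in-large
... | inj₂ ge = record { Nursery Ν ; outs = Nursery.ins Ν ; ins = Nursery.outs Ν }
  where
  Ν : Nursery (op T) k N E′ E Y
  -- `op (op T)` has the arcs of `T` but another trichotomy proof, so the `Out` sets are compared
  -- element by element.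
  Ν = nursery-≤ (op T) k N E′ E Y ge Y⊆ in-large (λ {v} v∈ → ≤-trans (out-large v∈)
    (p⊆q⇒∣p∣≤∣q∣ (λ x∈ → let e , x∈N = ∈Out∩⁻ T {U = N} {u = v} x∈ in ∈Out∩⁺ (op (op T)) e x∈N)))

-- D is the deleted set, s the root of a fan that survives.
module Approach {n} (T : Tournament (Fin n)) {k c m} {U H D : Subset n} (D<k : ∣ D ∣ < k)
  (F : Fans T U m c) {s} (s∈ : s ∈ Fans.roots F)
  (intact : ∀ {x} → x List.∈ Fans.low F → Fans.anchor F x ≡ s → x ∈ H ─ D)
  {low Y Q : List (Fin n)} {P front : Fin k → Subset n}
  (H-split : ∀ {v} → v ∈ H → v List.∈ low ⊎ v List.∈ Y ++ Q ⊎ ∃ λ i → v ∈ P i)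
  (YQ⊆ : ∀ {v} → v List.∈ Y ++ Q → v ∈ H × v ∈ U × v List.∉ Fans.low F)
  (outs : ∀ {v} → v List.∈ Y ++ Q → v ∉ Fans.exceptional F ⊎
          AtLeast k (λ q → q List.∈ Q × q ∉ Fans.exceptional F × Tournament._⇒_ T v q))
  (low⊆ : ∀ {v} → v List.∈ low → v ∈ H)
  (low-out : ∀ {v} → v List.∈ low → AtLeast k (λ q → q List.∈ Y × Tournament._⇒_ T v q))
  (to-front : ∀ {i x} → x ∈ P i → x ∉ front i →
              AtLeast k (λ y → y ∈ front i × Tournament._⇒_ T x y))
  (front-split : ∀ {i x} → x ∈ front i → x List.∈ low ⊎ x List.∈ Y) where

  open Tournament T
  open Fans F using (dominated; to-anchor; anchor-root; roots⊆)

  private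
    W = H ─ D

    s∈W : s ∈ W
    s∈W = intact (roots⊆ s∈) (anchor-root s∈)

    hop : ∀ {v} → v ∈ W → AtLeast k (λ x → v ⇒ x × x ∈ H × (x ∈ W → Reach T W x s)) → Reach T W v s
    hop v∈ some with AtLeast-avoid D D<k some
    ... | x , (v⇒x , x∈H , reach) , x∉D =
      let x∈W = x∈p∧x∉q⇒x∈p─q x∈H x∉D in (v∈ , v⇒x , x∈W) ◅ reach x∈W

    -- The fan of `s` survives as a whole, so an arc from `v` into it continues to its root.
    from-good : ∀ {v} → v List.∈ Y ++ Q → v ∉ Fans.exceptional F → v ∈ W → Reach T W v s
    from-good v∈YQ v∉E v∈ with YQ⊆ v∈YQ
    ... | _ , v∈U , v∉low with dominated v∈U v∉low v∉E s∈
    ... | x , x∈ , eq , v⇒x with to-anchor x∈ | intact x∈ eq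
    ... | inj₁ a≡x | x∈W = subst (Reach T W _) (trans (sym a≡x) eq) ((v∈ , v⇒x , x∈W) ◅ ε)
    ... | inj₂ x⇒a | x∈W = (v∈ , v⇒x , x∈W) ◅ (x∈W , subst (x ⇒_) eq x⇒a , s∈W) ◅ ε

    from-YQ : ∀ {v} → v List.∈ Y ++ Q → v ∈ W → Reach T W v s
    from-YQ v∈YQ v∈ with outs v∈YQ
    ... | inj₁ v∉E  = from-good v∈YQ v∉E v∈
    ... | inj₂ some = hop v∈ (AtLeast-map (λ (q∈ , q∉E , e) →
            e , proj₁ (YQ⊆ (∈-++⁺ʳ Y q∈)) , from-good (∈-++⁺ʳ Y q∈) q∉E) some)

    from-low : ∀ {v} → v List.∈ low → v ∈ W → Reach T W v s
    from-low v∈low v∈ = hop v∈ (AtLeast-map (λ (q∈ , e) →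
      e , proj₁ (YQ⊆ (∈-++⁺ˡ q∈)) , from-YQ (∈-++⁺ˡ q∈)) (low-out v∈low))

    from-front : ∀ {i v} → v ∈ front i → v ∈ W → Reach T W v s
    from-front v∈front = [ from-low , from-YQ ∘ ∈-++⁺ˡ ]′ (front-split v∈front)

    front⊆ : ∀ {i v} → v ∈ front i → v ∈ H
    front⊆ v∈front = [ low⊆ , proj₁ ∘ YQ⊆ ∘ ∈-++⁺ˡ ]′ (front-split v∈front)

  -- Every stage before the last offers `k` choices, of which `D` misses one: inner path vertices go
  -- to a front, fan vertices to `Y`, vertices of `Y ++ Q` to one that is not exceptional, and this
  -- one into the fan of `s`.
  reaches : ∀ {v} → v ∈ W → Reach T W v s
  reaches {v} v∈ with H-split (p─q⊆p H D v∈)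
  ... | inj₁ v∈low       = from-low v∈low v∈
  ... | inj₂ (inj₁ v∈YQ) = from-YQ v∈YQ v∈
  ... | inj₂ (inj₂ (i , v∈P)) with v ∈? front i
  ...   | yes v∈front = from-front v∈front v∈
  ...   | no v∉front  = hop v∈ (AtLeast-map (λ (y∈ , e) → e , front⊆ y∈ , from-front y∈)
                      (to-front v∈P v∉front))

-- These count the vertices of the 2k fans; the ends of the k paths together with
-- the new neighbours of fan vertices; and the vertices of the nursery.  In cost,
-- each path is charged 4, and low-bound twice: for the fan vertices deleted before
-- the paths are chosen, and for those deleted after.
low-bound fresh-bound nursery-bound cost : ℕ → ℕ
low-bound k     = k * (3 + k) + k * (3 + k)
fresh-bound k   = k * ((2 + k) + (2 + k)) + (low-bound k * k + low-bound k * k)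
nursery-bound k = fresh-bound k * k + (fresh-bound k + fresh-bound k * k) * k
cost k          = (low-bound k + (fresh-bound k + nursery-bound k)) + k * 4 + low-bound k

module Split {n : ℕ} (T : Tournament (Fin n)) {k : ℕ} (1≤k : 1 ≤ k) {U : Subset n}
  (A : Fans T U k (2 + k)) (B : Fans (op T) (U ─ fromList (Fans.low A)) k (2 + k)) where

  open Tournament T

  private
    module A = Fans A
    module B = Fans B

  low : List (Fin n)
  low = A.low ++ B.low

  ∣low∣≤ : length low ≤ low-bound k
  ∣low∣≤ = subst (_≤ low-bound k) (sym (length-++ A.low)) (+-mono-≤ A.size B.size)

  N : Subset n
  N = U ─ fromList low

  A-disjoint-B : ∀ {x} → x List.∈ A.low → x List.∉ B.low
  A-disjoint-B x∈A x∈B = proj₂ (x∈p─q⁻ U (fromList A.low) (B.low⊆ x∈B)) (∈-fromList⁺ x∈A)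

  low⊆ : ∀ {x} → x List.∈ low → x ∈ U
  low⊆ = [ A.low⊆ , p─q⊆p U (fromList A.low) ∘ B.low⊆ ]′ ∘ ∈-++⁻ A.low

  N⁺ : ∀ {x} → x ∈ U → x List.∉ low → x ∈ N
  N⁺ x∈ x∉ = x∈p∧x∉q⇒x∈p─q x∈ (x∉ ∘ ∈-fromList⁻ low)

  N⁻ : ∀ {x} → x ∈ N → x ∈ U × x List.∉ low
  N⁻ x∈ with x∈p─q⁻ U (fromList low) x∈
  ... | x∈U , x∉ = x∈U , x∉ ∘ ∈-fromList⁺

  N⊆′ : ∀ {x} → x ∈ N → x ∈ U ─ fromList A.low
  N⊆′ x∈ with N⁻ x∈
  ... | x∈U , x∉ = x∈p∧x∉q⇒x∈p─q x∈U (x∉ ∘ ∈-++⁺ˡ ∘ ∈-fromList⁻ A.low)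

  -- Removing the fan vertices other than roots before linking keeps the paths off the fans, except
  -- at roots.
  spare? : Decidable (λ x → x List.∈ low × x ∉ A.roots × x ∉ B.roots)
  spare? x = x ∈ₗ? low ×-dec ¬? (x ∈? A.roots) ×-dec ¬? (x ∈? B.roots)

  G : Subset n
  G = U ─ ⟪ spare? ⟫

  ∣spare∣≤ : ∣ ⟪ spare? ⟫ ∣ ≤ low-bound k
  ∣spare∣≤ = ≤-trans (p⊆q⇒∣p∣≤∣q∣ (∈-fromList⁺ ∘ proj₁ ∘ ∈⟪⟫⁻ spare?)) (≤-trans (∣fromList∣≤ low) ∣low∣≤)

  A-roots⊆G : A.roots ⊆ G
  A-roots⊆G x∈ = x∈p∧x∉q⇒x∈p─q (A.low⊆ (A.roots⊆ x∈)) (λ x∈′ → proj₁ (proj₂ (∈⟪⟫⁻ spare? x∈′)) x∈)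

  B-roots⊆G : B.roots ⊆ G
  B-roots⊆G x∈ = x∈p∧x∉q⇒x∈p─q (p─q⊆p U (fromList A.low) (B.low⊆ (B.roots⊆ x∈)))
    (λ x∈′ → proj₂ (proj₂ (∈⟪⟫⁻ spare? x∈′)) x∈)

  -- One map for both families: fan vertices go to the roots of their fans and all other vertices
  -- are fixed, so a deletion inside a fan is charged to the path through its root.
  anchor : Fin n → Fin n
  anchor x = A.anchor (B.anchor x)

  anchor-A : ∀ {x} → x List.∈ A.low → anchor x ≡ A.anchor x
  anchor-A x∈ = cong A.anchor (B.anchor-other (A-disjoint-B x∈))

  anchor-B : ∀ {x} → x List.∈ B.low → anchor x ≡ B.anchor x
  anchor-B x∈ = A.anchor-other (λ x∈A → A-disjoint-B x∈A (B.roots⊆ (B.anchor-low x∈)))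

  anchor-G : ∀ {x} → x ∈ G → anchor x ≡ x
  anchor-G {x} x∈ with x∈p─q⁻ U ⟪ spare? ⟫ x∈ | x ∈ₗ? A.low | x ∈ₗ? B.low
  ... | _ , x∉ | no x∉A | no x∉B = trans (cong A.anchor (B.anchor-other x∉B)) (A.anchor-other x∉A)
  ... | _ , x∉ | yes x∈A | _ with x ∈? A.roots
  ...   | yes x∈S = trans (anchor-A x∈A) (A.anchor-root x∈S)
  ...   | no x∉S  = contradiction (∈⟪⟫⁺ spare? (∈-++⁺ˡ x∈A , x∉S , A-disjoint-B x∈A ∘ B.roots⊆)) x∉
  anchor-G {x} x∈ | _ , x∉ | no x∉A | yes x∈B with x ∈? B.roots
  ...   | yes x∈S = trans (anchor-B x∈B) (B.anchor-root x∈S)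
  ...   | no x∉S  = contradiction (∈⟪⟫⁺ spare? (∈-++⁺ʳ A.low x∈B , x∉A ∘ A.roots⊆ , x∉S)) x∉

  -- X⁺ and X⁻ supply neighbours outside low to the vertices of low.
  module _ {κ} (L : Linkage T k k κ G A.roots B.roots) (X⁺ X⁻ : List (Fin n)) where

    private
      module L = Linkage L
      module Lᵢ (i : Fin k) = Link (L.links i)

    -- The fringe omits fan vertices, such as the roots in which the paths start and end; these get
    -- their neighbours from `X⁺` and `X⁻`.
    ends fringe : List (Fin n)
    ends   = concatMap (λ i → elements (Lᵢ.front i) ++ elements (Lᵢ.rear i)) (allFin k)
    fringe = filter (_∈? N) ends

    ∈fringe : ∀ {i x} → x ∈ Lᵢ.front i ⊎ x ∈ Lᵢ.rear i → x ∈ N → x List.∈ fringe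
    ∈fringe {i} x∈ x∈N = ∈-filter⁺ (_∈? N) (∈-concatMap⁺ _ (List.lose (∈-allFin i)
      ([ ∈-++⁺ˡ ∘ ∈-elements⁺ , ∈-++⁺ʳ (elements (Lᵢ.front i)) ∘ ∈-elements⁺ ]′ x∈))) x∈N

    ∣fringe∣≤ : length fringe ≤ k * ((2 + k) + (2 + k))
    ∣fringe∣≤ = ≤-trans (length-filter (_∈? N) ends)
      (subst (λ m → length ends ≤ m * ((2 + k) + (2 + k))) (length-tabulate {n = k} id)
        (length-concatMap≤ _ (λ i → subst (_≤ (2 + k) + (2 + k)) (sym (length-++ (elements (Lᵢ.front i))))
          (+-mono-≤ (≤-trans (length-elements (Lᵢ.front i)) (Lᵢ.∣front∣≤ i))
                    (≤-trans (length-elements (Lᵢ.rear i)) (Lᵢ.∣rear∣≤ i)))) (allFin k)))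

    fresh : List (Fin n)
    fresh = fringe ++ (X⁺ ++ X⁻)

    ∈fresh : ∀ {i x} → x ∈ Lᵢ.front i ⊎ x ∈ Lᵢ.rear i → x List.∈ low ⊎ x List.∈ fresh
    ∈fresh {i} {x} x∈ with x ∈ₗ? low
    ... | yes x∈low = inj₁ x∈low
    ... | no x∉low  = inj₂ (∈-++⁺ˡ (∈fringe {i} x∈ (N⁺ (p─q⊆p U _ (Lᵢ.path⊆ i
            ([ Lᵢ.front⊆ i , Lᵢ.rear⊆ i ]′ x∈))) x∉low)))

    module _ (X⁺⊆ : ∀ {x} → x List.∈ X⁺ → x ∈ N) (X⁻⊆ : ∀ {x} → x List.∈ X⁻ → x ∈ N)
      (low-out : ∀ {v} → v List.∈ low → AtLeast k (λ q → q List.∈ X⁺ × v ⇒ q))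
      (low-in : ∀ {v} → v List.∈ low → AtLeast k (λ q → q List.∈ X⁻ × q ⇒ v)) where

      fresh⊆ : ∀ {x} → x List.∈ fresh → x ∈ N
      fresh⊆ = [ proj₂ ∘ ∈-filter⁻ (_∈? N) {xs = ends} , [ X⁺⊆ , X⁻⊆ ]′ ∘ ∈-++⁻ X⁺ ]′ ∘ ∈-++⁻ fringe

      module _ (Ν : Nursery T k N A.exceptional B.exceptional fresh) where

        private module Ν = Nursery Ν

        kept : List (Fin n)
        kept = low ++ (fresh ++ Ν.Q)

        R H : Subset n
        R = L.rest ─ fromList kept
        H = U ─ R

        kept⊆ : ∀ {x} → x List.∈ kept → x ∈ U
        kept⊆ = [ low⊆ , proj₁ ∘ N⁻ ∘ [ fresh⊆ , Ν.Q⊆ ]′ ∘ ∈-++⁻ fresh ]′ ∘ ∈-++⁻ low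

        kept⊆H : ∀ {x} → x List.∈ kept → x ∈ H
        kept⊆H x∈ = x∈p∧x∉q⇒x∈p─q (kept⊆ x∈) λ x∈R → proj₂ (x∈p─q⁻ L.rest (fromList kept) x∈R) (∈-fromList⁺ x∈)

        path⊆H : ∀ {i x} → x ∈ Lᵢ.path i → x ∈ H
        path⊆H {i} x∈ = x∈p∧x∉q⇒x∈p─q (p─q⊆p U _ (Lᵢ.path⊆ i x∈))
          λ x∈R → L.avoids {i = i} (p─q⊆p L.rest _ x∈R) x∈

        H-split : ∀ {v} → v ∈ H → v List.∈ low ⊎ v List.∈ fresh ++ Ν.Q ⊎ ∃ λ i → v ∈ Lᵢ.path i
        H-split {v} v∈ with x∈p─q⁻ U R v∈ | v ∈ₗ? kept
        ... | _ , _ | yes v∈kept = [ inj₁ , inj₂ ∘ inj₁ ]′ (∈-++⁻ low v∈kept)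
        ... | v∈U , v∉R | no v∉kept = inj₂ (inj₂ (L.covered v∈G v∉rest))
          where
          v∈G : v ∈ G
          v∈G = x∈p∧x∉q⇒x∈p─q v∈U (v∉kept ∘ ∈-++⁺ˡ ∘ proj₁ ∘ ∈⟪⟫⁻ spare?)
          v∉rest : v ∉ L.rest
          v∉rest v∈rest = v∉R (x∈p∧x∉q⇒x∈p─q v∈rest (v∉kept ∘ ∈-fromList⁻ kept))

        YQ⊆N : ∀ {v} → v List.∈ fresh ++ Ν.Q → v ∈ N
        YQ⊆N = [ fresh⊆ , Ν.Q⊆ ]′ ∘ ∈-++⁻ fresh

        H-large : k < ∣ H ∣
        -- A root together with its `k` collected out-neighbours gives `k + 1` vertices of `H`.
        H-large with 0<∣p∣⇒Nonempty A.roots (≤-trans 1≤k A.m≤∣roots∣)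
        ... | a , a∈ with low-out (∈-++⁺ˡ (A.roots⊆ a∈))
        ...   | qs , qs! , refl , all = unique-length≤
          (All.map (λ (_ , a⇒q) a≡q → irrefl T (subst (a ⇒_) (sym a≡q) a⇒q)) all ∷ qs!)
          (kept⊆H (∈-++⁺ˡ (∈-++⁺ˡ (A.roots⊆ a∈))) ∷
           All.map (λ (q∈ , _) → kept⊆H (∈-++⁺ʳ low (∈-++⁺ˡ (∈-++⁺ʳ fringe (∈-++⁺ˡ q∈))))) all)

        H-strong : ∀ D → ∣ D ∣ < k → Strong T (H ─ D)
        -- Some path avoids `D` together with the fans at both its ends. The way from `u` to `v`
        -- goes to its start, along it, and from its end, the last part being found in the reversed
        -- tournament.
        H-strong D D<k with unhit-preimage anchor Lᵢ.path D D<k L.disjoint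
        ... | i , unhit = λ u∈ v∈ →
            to-start u∈ ◅◅ Reach-mono T path⊆W (Lᵢ.walk i) ◅◅ reverse (λ (a , e , b) → b , e , a) (to-end v∈)
          where
          path⊆W : Lᵢ.path i ⊆ H ─ D
          path⊆W x∈ = x∈p∧x∉q⇒x∈p─q (path⊆H {i} x∈)
            (unhit (subst (_∈ Lᵢ.path i) (sym (anchor-G (Lᵢ.path⊆ i x∈))) x∈))

          to-start : ∀ {u} → u ∈ H ─ D → Reach T (H ─ D) u (Lᵢ.start i)
          to-start = Approach.reaches T {H = H} D<k A (Lᵢ.start∈S i)
            (λ x∈ eq → x∈p∧x∉q⇒x∈p─q (kept⊆H (∈-++⁺ˡ (∈-++⁺ˡ x∈)))
              (unhit (subst (_∈ Lᵢ.path i) (sym (trans (anchor-A x∈) eq)) (Lᵢ.start∈ i))))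
            {low} {fresh} {Ν.Q} {Lᵢ.path} {Lᵢ.front} H-split
            (λ v∈ → kept⊆H (∈-++⁺ʳ low v∈) , proj₁ (N⁻ (YQ⊆N v∈)) , proj₂ (N⁻ (YQ⊆N v∈)) ∘ ∈-++⁺ˡ)
            Ν.outs (kept⊆H ∘ ∈-++⁺ˡ)
            (λ v∈ → AtLeast-map (λ (q∈ , e) → ∈-++⁺ʳ fringe (∈-++⁺ˡ q∈) , e) (low-out v∈))
            (λ {i} → Lᵢ.to-front i) (λ {i} x∈ → ∈fresh {i} (inj₁ x∈))

          to-end : ∀ {v} → v ∈ H ─ D → Reach (op T) (H ─ D) v (Lᵢ.end i)
          to-end = Approach.reaches (op T) {H = H} D<k B (Lᵢ.end∈S′ i)
            (λ x∈ eq → x∈p∧x∉q⇒x∈p─q (kept⊆H (∈-++⁺ˡ (∈-++⁺ʳ A.low x∈)))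
              (unhit (subst (_∈ Lᵢ.path i) (sym (trans (anchor-B x∈) eq)) (Lᵢ.end∈ i))))
            {low} {fresh} {Ν.Q} {Lᵢ.path} {Lᵢ.rear} H-split
            (λ v∈ → kept⊆H (∈-++⁺ʳ low v∈) , N⊆′ (YQ⊆N v∈) , proj₂ (N⁻ (YQ⊆N v∈)) ∘ ∈-++⁺ʳ A.low)
            Ν.ins (kept⊆H ∘ ∈-++⁺ˡ)
            (λ v∈ → AtLeast-map (λ (q∈ , e) → ∈-++⁺ʳ fringe (∈-++⁺ʳ X⁺ q∈) , e) (low-in v∈))
            (λ {i} → Lᵢ.from-rear i) (λ {i} x∈ → ∈fresh {i} (inj₂ x∈))

        H-conn : Conn T k H
        H-conn = H-large , H-strong

        R⊆U : R ⊆ U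
        R⊆U = p─q⊆p U _ ∘ L.rest⊆ ∘ p─q⊆p L.rest _

-- Arithmetic of the constants

k≤2^k : ∀ k → k ≤ 2 ^ k
k≤2^k zero    = z≤n
k≤2^k (suc k) = ≤-trans (s≤s (k≤2^k k)) (≤-trans (+-monoˡ-≤ (2 ^ k) (m^n>0 2 k))
  (≤-reflexive (cong (2 ^ k +_) (sym (+-identityʳ (2 ^ k))))))

-- This is why fans use `2 + k` halvings: `2 ^ k` absorbs the number `k` of fans and the other two
-- give the factor 4.
few⇒4*≤ : ∀ {k e d} → 1 ≤ k → 2 ^ (2 + k) * e ≤ k * d → 4 * e ≤ d
few⇒4*≤ {k@(suc _)} {e} {d} _ le = *-cancelˡ-≤ k (begin
  k * (4 * e)     ≤⟨ *-monoˡ-≤ (4 * e) (k≤2^k k) ⟩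
  2 ^ k * (4 * e) ≡⟨ solve 2 (λ p e → p :* (con 4 :* e) := con 2 :* (con 2 :* p) :* e) refl (2 ^ k) e ⟩
  2 ^ (2 + k) * e ≤⟨ le ⟩
  k * d           ∎)
  where open ≤-Reasoning

-- Of a degree `d` in `U`, one half pays for `k` and the `l` fan vertices, the other half for twice
-- the exceptional set.
room : ∀ {k l e d d′} → 4 * e ≤ d → 2 * (k + l) ≤ d → d ≤ d′ + l → k + 2 * e ≤ d′
room {k} {l} {e} {d} {d′} 4e≤d 2k+2l≤d d≤ = +-cancelʳ-≤ l _ _ (≤-trans (*-cancelˡ-≤ 2 (begin
  2 * (k + 2 * e + l)   ≡⟨ solve 3 (λ k l e → con 2 :* (k :+ con 2 :* e :+ l) :=
                             con 2 :* (k :+ l) :+ con 4 :* e) refl k l e ⟩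
  2 * (k + l) + 4 * e   ≤⟨ +-mono-≤ 2k+2l≤d 4e≤d ⟩
  d + d                 ≡⟨ cong (d +_) (sym (+-identityʳ d)) ⟩
  2 * d                 ∎)) d≤)
  where open ≤-Reasoning

2*[k+low]≤cost : ∀ k → 2 * (k + low-bound k) ≤ cost k
2*[k+low]≤cost k = begin
  2 * (k + l)         ≡⟨ solve 2 (λ k l → con 2 :* (k :+ l) := l :+ k :* con 2 :+ l) refl k l ⟩
  l + k * 2 + l       ≤⟨ +-monoˡ-≤ l (+-mono-≤ (m≤m+n l _) (*-monoʳ-≤ k (s≤s (s≤s z≤n)))) ⟩
  cost k              ∎
  where
  open ≤-Reasoning
  l = low-bound k

cost≤108*k^6 : ∀ k → 1 ≤ k → cost k ≤ 108 * k ^ 6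
-- With `k = 1 + j` the difference of the two sides is a polynomial in `j` with nonnegative
-- coefficients; it vanishes at `j = 0`, where both sides are 108.
cost≤108*k^6 (suc j) _ = m+n≤o⇒m≤o (cost (suc j)) (≤-reflexive (solve 1 (λ j →
    let k = con 1 :+ j
        l = k :* (con 3 :+ k) :+ k :* (con 3 :+ k)
        y = k :* ((con 2 :+ k) :+ (con 2 :+ k)) :+ (l :* k :+ l :* k)
        q = y :* k :+ (y :+ y :* k) :* k
    in (l :+ (y :+ q)) :+ k :* con 4 :+ l
       :+ j :* (con 360 :+ j :* (con 1314
       :+ j :* (con 1996 :+ j :* (con 1578 :+ j :* (con 644 :+ j :* con 108)))))
       := con 108 :* (k :* (k :* (k :* (k :* (k :* (k :* con 1))))))) refl j))

-- For `suc t` classes there are `t` splits, and the last class still needs connectivity `k`. Since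
-- `k * suc t ^ 2` is at least 2, the logarithmic bound is at least its factor `c`, a polynomial
-- that exceeds the total cost.
threshold : ∀ k t → 1 ≤ k → 1 ≤ t →
  t * cost k + k ≤ ⌈ k ^ 6 * suc t ^ 3 * 10 ^ 7 ·log₂ (k * suc t ^ 2) ⌉
threshold k t 1≤k 1≤t = begin
  t * cost k + k                 ≤⟨ +-monoʳ-≤ (t * cost k) k≤cost ⟩
  t * cost k + cost k            ≡⟨ +-comm (t * cost k) (cost k) ⟩
  suc t * cost k                 ≤⟨ *-mono-≤ suct≤ (cost≤108*k^6 k 1≤k) ⟩
  suc t ^ 3 * (108 * k ^ 6)      ≤⟨ *-monoʳ-≤ (suc t ^ 3) (*-monoˡ-≤ (k ^ 6) 108≤) ⟩
  suc t ^ 3 * (10 ^ 7 * k ^ 6)   ≡⟨ solve 3 (λ x y z → x :* (y :* z) := z :* x :* y) refl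
                                      (suc t ^ 3) (10 ^ 7) (k ^ 6) ⟩
  c                              ≡⟨ sym (⌈log₂2^n⌉≡n c) ⟩
  ⌈log₂ 2 ^ c ⌉                  ≤⟨ ⌈log₂⌉-mono-≤ (^-monoˡ-≤ c 2≤) ⟩
  ⌈log₂ (k * suc t ^ 2) ^ c ⌉    ∎
  where
  open ≤-Reasoning
  c = k ^ 6 * suc t ^ 3 * 10 ^ 7
  108≤ : 108 ≤ 10 ^ 7
  108≤ = toWitness {a? = 108 ≤? 10 ^ 7} _
  k≤cost : k ≤ cost k
  k≤cost = ≤-trans (≤-trans (m≤m+n k _) (m≤n*m (k + low-bound k) 2)) (2*[k+low]≤cost k)
  suct≤ : suc t ≤ suc t ^ 3
  suct≤ = ≤-trans (≤-reflexive (sym (*-identityʳ (suc t)))) (^-monoʳ-≤ (suc t) {1} {3} (s≤s z≤n))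
  2≤ : 2 ≤ k * suc t ^ 2
  2≤ = ≤-trans (≤-trans (s≤s (subst (1 ≤_) (sym (*-identityʳ t)) 1≤t)) (^-monoʳ-≤ (suc t) {1} {2} (s≤s z≤n)))
               (m≤n*m (suc t ^ 2) k {{>-nonZero 1≤k}})

-- Assembling the partition

module _ {n : ℕ} (T : Tournament (Fin n)) where

  split : ∀ {k κ U} → 1 ≤ k → Conn T (κ + cost k) U →
          ∃ λ R → R ⊆ U × Conn T κ R × Conn T k (U ─ R)
  split {k} {κ} {U} 1≤k conn = with-fans A B
    where
    l = low-bound k
    c₁ = low-bound k + (fresh-bound k + nursery-bound k)
    2k+2l≤ : 2 * (k + l) ≤ κ + cost k
    2k+2l≤ = ≤-trans (2*[k+low]≤cost k) (m≤n+m (cost k) κ)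
    l≤∣U∣ : l ≤ ∣ U ∣
    l≤∣U∣ = ≤-trans (≤-trans (m≤n+m l k) (m≤n*m (k + l) 2)) (≤-trans 2k+2l≤ (<⇒≤ (proj₁ conn)))
    A : Fans T U k (2 + k)
    A = fans T U k (2 + k) (≤-trans (m≤m+n _ _) l≤∣U∣)
    B : Fans (op T) (U ─ fromList (Fans.low A)) k (2 + k)
    B = fans (op T) _ k (2 + k) (+-cancelʳ-≤ (k * (3 + k)) _ _ (≤-trans l≤∣U∣ (≤-trans
      (∣p∣≤∣p─q∣+∣q∣ U (fromList (Fans.low A)))
      (+-monoʳ-≤ ∣ U ─ fromList (Fans.low A) ∣ (≤-trans (∣fromList∣≤ (Fans.low A)) (Fans.size A))))))

    with-fans : (A : Fans T U k (2 + k)) (B : Fans (op T) (U ─ fromList (Fans.low A)) k (2 + k)) →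
                ∃ λ R → R ⊆ U × Conn T κ R × Conn T k (U ─ R)
    with-fans A B = with-links (linkage T k k
        (Conn-─ {T = T} {U = U} ⟪ Σ.spare? ⟫ Σ.∣spare∣≤ (subst (λ κ → Conn T κ U) eq conn))
        Σ.A-roots⊆G Σ.B-roots⊆G (Fans.m≤∣roots∣ A) (Fans.m≤∣roots∣ B))
        (collect T k Σ.N Σ.low (λ v∈ → low-large T conn (Σ.low⊆ v∈)))
        (collect (op T) k Σ.N Σ.low (λ v∈ → low-large (op T) (Conn-op {T = T} conn) (Σ.low⊆ v∈)))
      where
      module Σ = Split T 1≤k A B
      -- From right to left, the terms are spent on the spare fan vertices, on the `k` paths and on
      -- `kept`.
      eq : κ + cost k ≡ κ + c₁ + k * 4 + l
      eq = solve 4 (λ κ c m l → κ :+ (c :+ m :+ l) := κ :+ c :+ m :+ l) refl κ c₁ (k * 4) l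

      ∣Out∩U∣≤ : ∀ (T′ : Tournament (Fin n)) v → ∣ Out T′ v ∩ U ∣ ≤ ∣ Out T′ v ∩ Σ.N ∣ + l
      ∣Out∩U∣≤ T′ v = ≤-trans (∣q∩r∣≤ (Out T′ v) U (fromList Σ.low))
        (+-monoʳ-≤ ∣ Out T′ v ∩ Σ.N ∣ (≤-trans (∣fromList∣≤ Σ.low) Σ.∣low∣≤))

      low-large : ∀ T′ → Conn T′ (κ + cost k) U → ∀ {v} → v ∈ U → k ≤ ∣ Out T′ v ∩ Σ.N ∣
      low-large T′ conn′ {v} v∈ = +-cancelʳ-≤ l k _ (≤-trans (≤-trans (m≤n*m (k + l) 2) 2k+2l≤)
        (≤-trans (Conn⇒≤outdegree T′ conn′ v∈) (∣Out∩U∣≤ T′ v)))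

      N-large : ∀ T′ → Conn T′ (κ + cost k) U → ∀ {e v} → v ∈ U → 2 ^ (2 + k) * e ≤ k * ∣ Out T′ v ∩ U ∣ →
                k + 2 * e ≤ ∣ Out T′ v ∩ Σ.N ∣
      N-large T′ conn′ {e} {v} v∈ few = room {k} {l} {e} (few⇒4*≤ {k} {e} 1≤k few)
        (≤-trans 2k+2l≤ (Conn⇒≤outdegree T′ conn′ v∈)) (∣Out∩U∣≤ T′ v)

      with-links : Linkage T k k (κ + c₁) Σ.G (Fans.roots A) (Fans.roots B) →
        (∃ λ X → length X ≤ length Σ.low * k × (∀ {q} → q List.∈ X → q ∈ Σ.N) ×
          (∀ {x} → x List.∈ Σ.low → AtLeast k (λ q → q List.∈ X × Tournament._⇒_ T x q))) →
        (∃ λ X → length X ≤ length Σ.low * k × (∀ {q} → q List.∈ X → q ∈ Σ.N) ×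
          (∀ {x} → x List.∈ Σ.low → AtLeast k (λ q → q List.∈ X × Tournament._⇒_ T q x))) →
        ∃ λ R → R ⊆ U × Conn T κ R × Conn T k (U ─ R)
      with-links L (X⁺ , X⁺≤ , X⁺⊆ , low-out) (X⁻ , X⁻≤ , X⁻⊆ , low-in) =
        with-nursery (nursery T k Σ.N (Fans.exceptional A) (Fans.exceptional B) Y
          (Σ.fresh⊆ L X⁺ X⁻ X⁺⊆ X⁻⊆ low-out low-in)
          (λ v∈ → N-large T conn (proj₁ (Σ.N⁻ v∈)) (Fans.few A (proj₁ (Σ.N⁻ v∈)) (proj₂ (Σ.N⁻ v∈) ∘ ∈-++⁺ˡ)))
          (λ {v} v∈ → N-large (op T) (Conn-op {T = T} conn) (proj₁ (Σ.N⁻ v∈))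
            -- The fans `B` live in `U` without the fans `A`; passing to degrees in `U` only
            -- enlarges the right-hand side.
            (≤-trans (Fans.few B (Σ.N⊆′ v∈) (proj₂ (Σ.N⁻ v∈) ∘ ∈-++⁺ʳ (Fans.low A)))
              (*-monoʳ-≤ k (p⊆q⇒∣p∣≤∣q∣ (λ {x} x∈ → let x∈Out , x∈U′ = x∈p∩q⁻ (Out (op T) v) _ x∈ in
                x∈p∩q⁺ (x∈Out , p─q⊆p U _ x∈U′)))))))
        where
        Y = Σ.fresh L X⁺ X⁻
        ∣Y∣≤ : length Y ≤ fresh-bound k
        ∣Y∣≤ = subst (_≤ fresh-bound k) (sym (length-++ (Σ.fringe L X⁺ X⁻))) (+-mono-≤ (Σ.∣fringe∣≤ L X⁺ X⁻)
          (subst (_≤ l * k + l * k) (sym (length-++ X⁺)) (+-mono-≤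
            (≤-trans X⁺≤ (*-monoˡ-≤ k Σ.∣low∣≤)) (≤-trans X⁻≤ (*-monoˡ-≤ k Σ.∣low∣≤)))))
        with-nursery : Nursery T k Σ.N (Fans.exceptional A) (Fans.exceptional B) Y →
                       ∃ λ R → R ⊆ U × Conn T κ R × Conn T k (U ─ R)
        with-nursery Ν = R , Σ.R⊆U L X⁺ X⁻ X⁺⊆ X⁻⊆ low-out low-in Ν
          , Conn-─ {T = T} (fromList kept) (≤-trans (∣fromList∣≤ kept) ∣kept∣≤) (Linkage.conn L)
          , Σ.H-conn L X⁺ X⁻ X⁺⊆ X⁻⊆ low-out low-in Ν
          where
          R = Σ.R L X⁺ X⁻ X⁺⊆ X⁻⊆ low-out low-in Ν
          kept = Σ.kept L X⁺ X⁻ X⁺⊆ X⁻⊆ low-out low-in Ν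
          ∣kept∣≤ : length kept ≤ c₁
          ∣kept∣≤ = subst (_≤ c₁) (sym (length-++ Σ.low)) (+-mono-≤ Σ.∣low∣≤
            (subst (_≤ fresh-bound k + nursery-bound k) (sym (length-++ Y)) (+-mono-≤ ∣Y∣≤
              (≤-trans (Nursery.size Ν) (+-mono-≤ (*-monoˡ-≤ k ∣Y∣≤)
                (*-monoˡ-≤ k (+-mono-≤ ∣Y∣≤ (*-monoˡ-≤ k ∣Y∣≤))))))))

  -- Each split pays `cost k` for the class `U ─ R`, and the recursion continues in `R`; the last
  -- class is whatever remains.
  partition : ∀ {k} → 1 ≤ k → ∀ t U → Conn T (t * cost k + k) U →
    ∃ λ (V : Fin (suc t) → Subset n) →
      (∀ i → V i ⊆ U) × (∀ v → v ∈ U → ∃! _≡_ (λ i → v ∈ V i)) × (∀ i → Conn T k (V i))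
  partition 1≤k zero U conn = (λ _ → U) , (λ _ → id) , (λ _ v∈ → zero , v∈ , λ { {zero} _ → refl }) , λ _ → conn
  partition {k} 1≤k (suc t) U conn = extend (split {κ = t * cost k + k} 1≤k (subst (λ κ → Conn T κ U) eq conn))
    where
    eq : suc t * cost k + k ≡ t * cost k + k + cost k
    eq = trans (+-assoc (cost k) (t * cost k) k) (+-comm (cost k) (t * cost k + k))

    extend : (∃ λ R → R ⊆ U × Conn T (t * cost k + k) R × Conn T k (U ─ R)) → _
    extend (R , R⊆ , R-conn , H-conn) with partition 1≤k t R R-conn
    ... | V , V⊆ , V! , V-conn = W , W⊆ , W! , W-conn
      where
      W : Fin (suc (suc t)) → Subset n
      W zero    = U ─ R
      W (suc i) = V i
      W⊆ : ∀ i → W i ⊆ U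
      W⊆ zero    = p─q⊆p U R
      W⊆ (suc i) = R⊆ ∘ V⊆ i
      W-conn : ∀ i → Conn T k (W i)
      W-conn zero    = H-conn
      W-conn (suc i) = V-conn i
      W! : ∀ v → v ∈ U → ∃! _≡_ (λ i → v ∈ W i)
      W! v v∈ with v ∈? R
      ... | no v∉R = zero , x∈p∧x∉q⇒x∈p─q v∈ v∉R
        , λ { {zero} _ → refl ; {suc i} v∈V → contradiction (V⊆ i v∈V) v∉R }
      ... | yes v∈R with V! v v∈R
      ...   | i , v∈V , unique = suc i , v∈V
        , λ { {zero} v∈H → contradiction v∈R (proj₂ (x∈p─q⁻ U R v∈H))
            ; {suc j} v∈V′ → cong suc (unique v∈V′) }

theorem1p2 : ∀ (n : ℕ) (T : Tournament (Fin n)) (k t : ℕ) → 1 ≤ k → 2 ≤ t →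
    StronglyKConnected ⌈ k ^ 6 * t ^ 3 * 10 ^ 7 ·log₂ (k * t ^ 2) ⌉ T ⊤ →
    ∃ λ (V : Fin t → Subset n) →
    IsPartition V × (∀ i → StronglyKConnected k T (V i))
theorem1p2 n T k (suc t) 1≤k (s≤s 1≤t) conn = result
    (partition T 1≤k t ⊤ (Conn-≤ {T = T} (threshold k t 1≤k 1≤t) (StronglyKConnected⇒Conn {T = T} conn)))
  where
  result : (∃ λ (V : Fin (suc t) → Subset n) → (∀ i → V i ⊆ ⊤) ×
             (∀ v → v ∈ ⊤ → ∃! _≡_ (λ i → v ∈ V i)) × (∀ i → Conn T k (V i))) →
           ∃ λ (V : Fin (suc t) → Subset n) → IsPartition V × (∀ i → StronglyKConnected k T (V i))
  result (V , _ , V! , V-conn) = V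
    , ((λ i → 0<∣p∣⇒Nonempty (V i) (≤-trans (s≤s z≤n) (proj₁ (V-conn i)))) , λ v → V! v ∈⊤)
    , λ i → Conn⇒StronglyKConnected {T = T} (V-conn i)
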